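{- For every Boolean function $f\colon\{0,1\}^n\to\{0,1\}$, $D(f)\le 4\,\mathrm{sdeg}(f)^2\,\mathrm{rdeg}(f)^2$.
   Context: A rational representation of $f$ is a pair of multilinear $p,q\in\mathbb{R}[X_1,\dots,X_n]$ with $q(x)\neq 0$ and $p(x)/q(x)=f(x)$ for all $x\in\{0,1\}^n$; $\mathrm{rdeg}(f)$ is the minimum of $\max(\deg p,\deg q)$ over rational representations. A sign representation of $f$ is a multilinear real polynomial $p$ with $p(x)\neq0$ for all $x\in\{0,1\}^n$ and $p(x)<0$ iff $f(x)=1$; $\mathrm{sdeg}(f)$ is the minimum degree of a sign representation. $D(f)$ is the minimum depth of a deterministic decision tree that queries bits of $x$ and outputs $f(x)$ exactly for every $x\in\{0,1\}^n$.
   Formalization: The polynomials in sign representations and rational representations have rational instead of real coefficients, so sdeg(f) and rdeg(f) are taken over the rationals; by density of rational points these minima equal the real ones. -}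

module Defs where

open import Data.Bool using (Bool; true; false; if_then_else_)
open import Data.Nat using (ℕ; zero; suc; _≤_; _^_) renaming (_+_ to _+ℕ_; _*_ to _*ℕ_)
open import Data.Nat using (_⊔_)
open import Data.Fin using (Fin; zero; suc)
open import Data.Vec using (Vec; []; _∷_; lookup)
open import Data.List using (List; []; _∷_; map; _++_; foldr)
open import Data.Rational using (ℚ; 0ℚ; 1ℚ; _+_; _*_; _<_)
open import Data.Product using (Σ; _×_; _,_)
open import Relation.Binary.PropositionalEquality using (_≡_; _≢_)

Input : ℕ → Set
Input n = Vec Bool n

BoolFun : ℕ → Set
BoolFun n = Input n → Bool

bitℚ : Bool → ℚ
bitℚ true  = 1ℚ
bitℚ false = 0ℚ

allSubsets : (n : ℕ) → List (Vec Bool n)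
allSubsets zero    = [] ∷ []
allSubsets (suc n) = map (false ∷_) (allSubsets n) ++ map (true ∷_) (allSubsets n)

weight : {n : ℕ} → Vec Bool n → ℕ
weight []           = 0
weight (true  ∷ s)  = suc (weight s)
weight (false ∷ s)  = weight s

-- A multilinear polynomial in X_1..X_n is given by its coefficient
-- function on monomials X_S = ∏_{i∈S} X_i.
MLPoly : ℕ → Set
MLPoly n = Vec Bool n → ℚ

monomial : {n : ℕ} → Vec Bool n → Input n → ℚ
monomial []          []       = 1ℚ
monomial (true  ∷ s) (b ∷ x)  = bitℚ b * monomial s x
monomial (false ∷ s) (b ∷ x)  = monomial s x

eval : {n : ℕ} → MLPoly n → Input n → ℚ
eval {n} p x = foldr (λ S acc → p S * monomial S x + acc) 0ℚ (allSubsets n)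

DegLe : {n : ℕ} → MLPoly n → ℕ → Set
DegLe p d = ∀ S → p S ≢ 0ℚ → weight S ≤ d

SignRep : {n : ℕ} → BoolFun n → MLPoly n → Set
SignRep f p = ∀ x → (eval p x ≢ 0ℚ) × ((eval p x < 0ℚ → f x ≡ true) × (f x ≡ true → eval p x < 0ℚ))

-- (p , q) is a rational representation of f : q(x) ≠ 0 and p(x)/q(x) = f(x),
-- i.e. p(x) = f(x) · q(x)
RatRep : {n : ℕ} → BoolFun n → MLPoly n → MLPoly n → Set
RatRep f p q = ∀ x → (eval q x ≢ 0ℚ) × (eval p x ≡ bitℚ (f x) * eval q x)

SdegLe : {n : ℕ} → BoolFun n → ℕ → Set
SdegLe {n} f d = Σ (MLPoly n) λ p → SignRep f p × DegLe p d

RdegLe : {n : ℕ} → BoolFun n → ℕ → Set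
RdegLe {n} f d = Σ (MLPoly n) λ p → Σ (MLPoly n) λ q → RatRep f p q × DegLe p d × DegLe q d

data DTree (n : ℕ) : Set where
  leaf  : Bool → DTree n
  query : Fin n → DTree n → DTree n → DTree n

runTree : {n : ℕ} → DTree n → Input n → Bool
runTree (leaf b) x = b
runTree (query i t₀ t₁) x = if lookup x i then runTree t₁ x else runTree t₀ x

depth : {n : ℕ} → DTree n → ℕ
depth (leaf _) = 0
depth (query i t₀ t₁) = suc (depth t₀ ⊔ depth t₁)

DLe : {n : ℕ} → BoolFun n → ℕ → Set
DLe {n} f d = Σ (DTree n) λ t → (∀ x → runTree t x ≡ f x) × (depth t ≤ d)

{-# OPTIONS --safe #-}
module Submission where

-- For each value c a rational representation (p , q) of f yields a polynomial that is nonzero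
-- exactly on f⁻¹(c): p for c = 1 and q − p for c = 0.  If M is one of its monomials of top
-- degree, every input can be changed inside M so that f becomes c.
--
-- Let g sign-represent f with degree s, let x maximise ∣g∣ =: B, and take disjoint top monomials
-- M₁, …, M_K for c = ¬ f(x).  Flip each Mᵢ independently with probability l.  The expectation of g
-- is a polynomial in l of degree ≤ s, bounded by B on [0,1], equal to ±B at 0, and with slope at 0
-- larger than KB in absolute value.  A Markov inequality at the endpoint, weaker than the sharp
-- 2s²B but with rational nodes, gives K ≤ 3s².
--
-- Querying all variables of a maximal disjoint family therefore costs at most 3s² times the degree
-- of the polynomial for c, and lowers that degree.  Once one of the two polynomials is constant so
-- is f, so the total is at most 3s²(r² + r − 1) ≤ 4s²r².

open import Defs
open import Data.Bool using (Bool; true; false; not; if_then_else_)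
open import Data.Bool.Properties using (¬-not) renaming (_≟_ to _≟ᵇ_)
open import Data.Empty using (⊥-elim)
open import Data.Fin using (Fin; zero; suc)
open import Data.Fin.Properties using (any?)
open import Data.List as List using (List; []; _∷_; foldr; length; concatMap)
import Data.List.Properties as List
open import Data.List.Membership.Propositional using (_∈_)
open import Data.List.Membership.Propositional.Properties using (∈-++⁺ˡ; ∈-++⁺ʳ; ∈-map⁺)
open import Data.List.Relation.Unary.All as All using (All; []; _∷_)
open import Data.List.Relation.Unary.All.Properties using (¬Any⇒All¬)
open import Data.List.Relation.Unary.AllPairs using (AllPairs; []; _∷_)
open import Data.List.Relation.Unary.Any as Any using (Any; here; there)
open import Data.List.Relation.Unary.Any.Properties using (++⁺ˡ; ++⁺ʳ)
open import Data.Maybe using (Maybe; just; nothing)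
open import Data.Nat as ℕ using (ℕ; zero; suc)
import Data.Nat.Properties as ℕ
open import Data.Nat.Tactic.RingSolver renaming (solve-∀ to solve-∀ℕ)
open import Data.Product using (Σ; ∃; _×_; _,_; proj₁; proj₂)
open import Data.Rational using (ℚ; 0ℚ; 1ℚ; _+_; _*_; _-_; -_; 1/_; _≤_; _<_; nonNegative; positive; >-nonZero)
open import Data.Rational.Properties
open import Data.Sum using (_⊎_; inj₁; inj₂)
open import Data.Unit using (⊤; tt)
open import Data.Vec using (Vec; []; _∷_; lookup; replicate; _[_]≔_)
open import Data.Vec.Properties using ([]≔-lookup)
open import Function using (_∘_)
open import Relation.Binary.Definitions using (tri<; tri≈; tri>)
open import Relation.Binary.PropositionalEquality using (_≡_; _≢_; refl; sym; trans; cong; cong₂; subst; subst₂; module ≡-Reasoning)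
open import Relation.Nullary using (¬_; Dec; yes; no; contradiction)
open import Relation.Nullary.Decidable using (decidable-stable; _×-dec_; ¬?)
open import Relation.Unary using (Decidable)
open import Tactic.RingSolver using (solve-∀)
open import Tactic.RingSolver.Core.AlmostCommutativeRing using (AlmostCommutativeRing; fromCommutativeRing)

-- Ordered-field arithmetic in the rationals.

ringℚ : AlmostCommutativeRing _ _
ringℚ = fromCommutativeRing +-*-commutativeRing isZero
  where
  isZero : ∀ x → Maybe (0ℚ ≡ x)
  isZero x with 0ℚ ≟ x
  ... | yes p = just p
  ... | no _ = nothing

2ℚ : ℚ
2ℚ = 1ℚ + 1ℚ

0≤1 : 0ℚ ≤ 1ℚ
0≤1 = nonNegative⁻¹ 1ℚ

0<1 : 0ℚ < 1ℚ
0<1 = positive⁻¹ 1ℚ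

0≤2 : 0ℚ ≤ 2ℚ
0≤2 = nonNegative⁻¹ 2ℚ

0<2 : 0ℚ < 2ℚ
0<2 = positive⁻¹ 2ℚ

-- Most inequalities below are certified in this form: the gap is written as a sum of products of
-- nonnegative factors, and the ring solver checks the identity.
≤-slack : ∀ {x y d} → x + d ≡ y → 0ℚ ≤ d → x ≤ y
≤-slack {x} {y} {d} eq 0≤d = subst₂ _≤_ (+-identityʳ x) eq (+-monoʳ-≤ x 0≤d)

0≤difference : ∀ {x y} → x ≤ y → 0ℚ ≤ y - x
0≤difference {x} {y} x≤y = subst (_≤ y - x) (+-inverseʳ x) (+-monoˡ-≤ (- x) x≤y)

0≤+ : ∀ {x y} → 0ℚ ≤ x → 0ℚ ≤ y → 0ℚ ≤ x + y
0≤+ {x} {y} p q = subst (_≤ x + y) (+-identityʳ 0ℚ) (+-mono-≤ p q)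

0<+ : ∀ {x y} → 0ℚ < x → 0ℚ ≤ y → 0ℚ < x + y
0<+ {x} {y} p q = subst (_< x + y) (+-identityʳ 0ℚ) (+-mono-<-≤ p q)

*-monoˡ : ∀ {c x y} → 0ℚ ≤ c → x ≤ y → c * x ≤ c * y
*-monoˡ {c} p x≤y = *-monoˡ-≤-nonNeg c {{nonNegative p}} x≤y

*-monoʳ : ∀ {c x y} → 0ℚ ≤ c → x ≤ y → x * c ≤ y * c
*-monoʳ {c} p x≤y = *-monoʳ-≤-nonNeg c {{nonNegative p}} x≤y

0≤* : ∀ {x y} → 0ℚ ≤ x → 0ℚ ≤ y → 0ℚ ≤ x * y
0≤* {x} {y} p q = subst (_≤ x * y) (*-zeroʳ x) (*-monoˡ p q)

0<* : ∀ {x y} → 0ℚ < x → 0ℚ < y → 0ℚ < x * y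
0<* {x} {y} p q = subst (_< x * y) (*-zeroʳ x) (*-monoʳ-<-pos x {{positive p}} q)

*-cancel-≤ : ∀ {c x y} → 0ℚ < c → c * x ≤ c * y → x ≤ y
*-cancel-≤ {c} p = *-cancelˡ-≤-pos c {{positive p}}

*-cancel-≡ : ∀ {c x y} → 0ℚ < c → c * x ≡ c * y → x ≡ y
*-cancel-≡ p eq = ≤-antisym (*-cancel-≤ p (≤-reflexive eq)) (*-cancel-≤ p (≤-reflexive (sym eq)))

inverse : ∀ {c} → 0ℚ < c → ∃ λ r → c * r ≡ 1ℚ × 0ℚ < r
inverse {c} p = r , cr≡1 , *-cancelˡ-<-nonNeg c {{nonNegative (<⇒≤ p)}} (subst₂ _<_ (sym (*-zeroʳ c)) (sym cr≡1) 0<1)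
  where
  r = 1/_ c {{>-nonZero p}}
  cr≡1 = *-inverseʳ c {{>-nonZero p}}

-- Recursive, so that `ι (suc n)` is `1ℚ + ι n` by definition and ring identities apply to it
-- directly.
ι : ℕ → ℚ
ι zero = 0ℚ
ι (suc n) = 1ℚ + ι n

0≤ι : ∀ n → 0ℚ ≤ ι n
0≤ι zero = ≤-refl
0≤ι (suc n) = 0≤+ 0≤1 (0≤ι n)

0<ι : ∀ n → 0ℚ < ι (suc n)
0<ι n = 0<+ 0<1 (0≤ι n)

ι-+ : ∀ m n → ι (m ℕ.+ n) ≡ ι m + ι n
ι-+ zero n = sym (+-identityˡ (ι n))
ι-+ (suc m) n = trans (cong (1ℚ +_) (ι-+ m n)) (sym (+-assoc 1ℚ (ι m) (ι n)))

ι-* : ∀ m n → ι (m ℕ.* n) ≡ ι m * ι n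
ι-* zero n = sym (*-zeroˡ (ι n))
ι-* (suc m) n = trans (ι-+ n (m ℕ.* n)) (trans (cong (ι n +_) (ι-* m n)) (step (ι m) (ι n)))
  where
  step : ∀ x y → y + x * y ≡ (1ℚ + x) * y
  step = solve-∀ ringℚ

ι-mono : ∀ {m n} → m ℕ.≤ n → ι m ≤ ι n
ι-mono {m} {n} m≤n = ≤-slack (trans (sym (ι-+ m (n ℕ.∸ m))) (cong ι (ℕ.m+[n∸m]≡n m≤n))) (0≤ι (n ℕ.∸ m))

infixr 8 _^ℚ_
_^ℚ_ : ℚ → ℕ → ℚ
x ^ℚ zero = 1ℚ
x ^ℚ suc n = x * x ^ℚ n

0≤^ : ∀ {x} → 0ℚ ≤ x → ∀ n → 0ℚ ≤ x ^ℚ n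
0≤^ p zero = 0≤1
0≤^ p (suc n) = 0≤* p (0≤^ p n)

0<^ : ∀ {x} → 0ℚ < x → ∀ n → 0ℚ < x ^ℚ n
0<^ p zero = 0<1
0<^ p (suc n) = 0<* p (0<^ p n)

^-mono : ∀ {x y} → 0ℚ ≤ x → x ≤ y → ∀ n → x ^ℚ n ≤ y ^ℚ n
^-mono 0≤x x≤y zero = ≤-refl
^-mono 0≤x x≤y (suc n) = ≤-trans (*-monoˡ 0≤x (^-mono 0≤x x≤y n)) (*-monoʳ (0≤^ (≤-trans 0≤x x≤y) n) x≤y)

-- Univariate polynomials as functions.

-- Horner form. The strict degree bound lets 0 stand for the zero polynomial, so that dividing by a
-- linear factor always lowers the index by one.
PolyLt : ℕ → (ℚ → ℚ) → Set
PolyLt zero g = ∀ x → g x ≡ 0ℚ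
PolyLt (suc d) g = Σ ℚ λ c → Σ (ℚ → ℚ) λ h → PolyLt d h × (∀ x → g x ≡ c + x * h x)

PolyLt-ext : ∀ d {g h} → (∀ x → g x ≡ h x) → PolyLt d h → PolyLt d g
PolyLt-ext zero eq p x = trans (eq x) (p x)
PolyLt-ext (suc d) eq (c , h , p , e) = c , h , p , λ x → trans (eq x) (e x)

PolyLt-0 : ∀ d → PolyLt d (λ _ → 0ℚ)
PolyLt-0 zero x = refl
PolyLt-0 (suc d) = 0ℚ , (λ _ → 0ℚ) , PolyLt-0 d , λ x → step x
  where
  step : ∀ x → 0ℚ ≡ 0ℚ + x * 0ℚ
  step = solve-∀ ringℚ

PolyLt-const : ∀ d c → PolyLt (suc d) (λ _ → c)
PolyLt-const d c = c , (λ _ → 0ℚ) , PolyLt-0 d , λ x → step c x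
  where
  step : ∀ c x → c ≡ c + x * 0ℚ
  step = solve-∀ ringℚ

PolyLt-suc : ∀ d {g} → PolyLt d g → PolyLt (suc d) g
PolyLt-suc zero p = PolyLt-ext 1 p (PolyLt-0 1)
PolyLt-suc (suc d) (c , h , p , e) = c , h , PolyLt-suc d p , e

PolyLt-+ : ∀ d {g h} → PolyLt d g → PolyLt d h → PolyLt d (λ x → g x + h x)
PolyLt-+ zero p q x = cong₂ _+_ (p x) (q x)
PolyLt-+ (suc d) (a , g , p , e) (b , h , q , e′) =
  a + b , (λ x → g x + h x) , PolyLt-+ d p q ,
  λ x → trans (cong₂ _+_ (e x) (e′ x)) (step a b x (g x) (h x))
  where
  step : ∀ a b x u v → a + x * u + (b + x * v) ≡ a + b + x * (u + v)
  step = solve-∀ ringℚ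

PolyLt-scale : ∀ d a {g} → PolyLt d g → PolyLt d (λ x → a * g x)
PolyLt-scale zero a p x = trans (cong (a *_) (p x)) (*-zeroʳ a)
PolyLt-scale (suc d) a (c , h , p , e) =
  a * c , (λ x → a * h x) , PolyLt-scale d a p , λ x → trans (cong (a *_) (e x)) (step a c x (h x))
  where
  step : ∀ a c x u → a * (c + x * u) ≡ a * c + x * (a * u)
  step = solve-∀ ringℚ

PolyLt-linear : ∀ d a b {g} → PolyLt d g → PolyLt (suc d) (λ x → (a + b * x) * g x)
PolyLt-linear d a b {g} p =
  PolyLt-ext (suc d) (λ x → step a b x (g x))
    (PolyLt-+ (suc d) (PolyLt-suc d (PolyLt-scale d a p)) (0ℚ , (λ x → b * g x) , PolyLt-scale d b p , λ x → refl))
  where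
  step : ∀ a b x u → (a + b * x) * u ≡ a * u + (0ℚ + x * (b * u))
  step = solve-∀ ringℚ

-- Division by x - a in Horner form: from h x = h a + (x - a) v x follows c + x h x = (c + a h a) +
-- (x - a)(h x + a v x).
factor : ∀ d {g} → PolyLt (suc d) g → ∀ a → ∃ λ v → PolyLt d v × (∀ x → g x ≡ g a + (x - a) * v x)
factor zero {g} (c , h , p , e) a = (λ _ → 0ℚ) , (λ _ → refl) , λ x →
  trans (constant x) (trans (sym (constant a)) (step (g a) x a))
  where
  constant : ∀ x → g x ≡ c
  constant x = trans (e x) (trans (cong (λ u → c + x * u) (p x)) (trans (cong (c +_) (*-zeroʳ x)) (+-identityʳ c)))
  step : ∀ c x a → c ≡ c + (x - a) * 0ℚ
  step = solve-∀ ringℚ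
factor (suc d) {g} (c , h , p , e) a with factor d p a
... | v , q , e′ = (λ x → h x + a * v x) , PolyLt-+ (suc d) p (PolyLt-scale (suc d) a (PolyLt-suc d q)) , λ x →
  trans (e x) (trans (trans (cong (λ u → c + x * u) (e′ x)) (step c x a (h a) (v x)))
    (cong₂ (λ u w → u + (x - a) * (w + a * v x)) (sym (e a)) (sym (e′ x))))
  where
  step : ∀ c x a u v → c + x * (u + (x - a) * v) ≡ c + a * u + (x - a) * (u + (x - a) * v + a * v)
  step = solve-∀ ringℚ

-- The substitution l = 2y / (σ + y), which for σ = s² maps y = 0, 1, 4, …, s² to rational nodes in
-- [0,1] distributed much like the Chebyshev nodes.
homogenise : ∀ σ d {u} → PolyLt (suc d) u →
  ∃ λ G → PolyLt (suc d) G × (∀ y l → l * (σ + y) ≡ 2ℚ * y → G y ≡ (σ + y) ^ℚ d * u l)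
homogenise σ zero {u} (c , h , p , e) = (λ _ → c) , PolyLt-const 0 c , λ y l _ →
  trans (step c l) (cong (1ℚ *_) (trans (cong (λ w → c + l * w) (sym (p l))) (sym (e l))))
  where
  step : ∀ c l → c ≡ 1ℚ * (c + l * 0ℚ)
  step = solve-∀ ringℚ
homogenise σ (suc d) {u} (c , h , p , e) with homogenise σ d p
... | G , q , e′ =
  (λ y → c * (σ + y) ^ℚ suc d + (0ℚ + 2ℚ * y) * G y) ,
  PolyLt-+ (suc (suc d)) (PolyLt-scale (suc (suc d)) c (power (suc d))) (PolyLt-linear (suc d) 0ℚ 2ℚ q) ,
  λ y l eq → trans (cong₂ (λ w z → c * (σ + y) ^ℚ suc d + (0ℚ + w) * z) (sym eq) (e′ y l eq))
    (trans (step c l (σ + y) ((σ + y) ^ℚ d) (h l)) (cong ((σ + y) ^ℚ suc d *_) (sym (e l))))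
  where
  step : ∀ c l D E w → c * (D * E) + (0ℚ + l * D) * (E * w) ≡ D * E * (c + l * w)
  step = solve-∀ ringℚ
  one : ∀ σ y → σ + y ≡ σ + 1ℚ * y
  one = solve-∀ ringℚ
  power : ∀ n → PolyLt (suc n) (λ y → (σ + y) ^ℚ n)
  power zero = PolyLt-const 0 1ℚ
  power (suc n) = PolyLt-ext (suc (suc n)) (λ y → cong (_* (σ + y) ^ℚ n) (one σ y)) (PolyLt-linear (suc n) σ 1ℚ (power n))

-- Alternating sums of binomial ratios.

alternating : (ℕ → ℚ) → ℕ → ℕ → ℚ
alternating x m zero = 0ℚ
alternating x m (suc L) = x m - alternating x (suc m) L

alternating-linear : ∀ {x y z a b} → (∀ k → x k ≡ a * y k + b * z k) → ∀ m L →
  alternating x m L ≡ a * alternating y m L + b * alternating z m L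
alternating-linear {a = a} {b} eq m zero = step a b
  where
  step : ∀ a b → 0ℚ ≡ a * 0ℚ + b * 0ℚ
  step = solve-∀ ringℚ
alternating-linear {x} {y} {z} {a} {b} eq m (suc L) =
  trans (cong₂ _-_ (eq m) (alternating-linear {y = y} {z} {a} {b} eq (suc m) L))
    (step a b (y m) (z m) (alternating y (suc m) L) (alternating z (suc m) L))
  where
  step : ∀ a b y z s t → a * y + b * z - (a * s + b * t) ≡ a * (y - s) + b * (z - t)
  step = solve-∀ ringℚ

alternating-drop-last : ∀ {x} m L → x (m ℕ.+ L) ≡ 0ℚ → alternating x m (suc L) ≡ alternating x m L
alternating-drop-last {x} m zero eq = cong (_- 0ℚ) (trans (cong x (sym (ℕ.+-identityʳ m))) eq)
alternating-drop-last {x} m (suc L) eq =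
  cong (λ w → x m - w) (alternating-drop-last (suc m) L (trans (cong x (sym (ℕ.+-suc m L))) eq))

-- The ratio C(2s,s+k) / C(2s,s).
ratio : ℕ → ℕ → ℚ
ratio s zero = 1ℚ
ratio s (suc k) = (ι s - ι k) * proj₁ (inverse (0<ι (s ℕ.+ k))) * ratio s k

-- The recurrence (s + k + 1) C(2s,s+k+1) = (s - k) C(2s,s+k). It holds for every k, since beyond s
-- the ratio contains the factor s - s.
ratio-suc : ∀ s k → (ι s + ι (suc k)) * ratio s (suc k) ≡ (ι s - ι k) * ratio s k
ratio-suc s k = begin
  (ι s + (1ℚ + ι k)) * ((ι s - ι k) * r * ratio s k) ≡⟨ step (ι s) (ι k) r (ratio s k) ⟩
  (1ℚ + (ι s + ι k)) * r * ((ι s - ι k) * ratio s k) ≡⟨ cong (λ w → (1ℚ + w) * r * ((ι s - ι k) * ratio s k)) (sym (ι-+ s k)) ⟩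
  ι (suc (s ℕ.+ k)) * r * ((ι s - ι k) * ratio s k)  ≡⟨ cong (_* ((ι s - ι k) * ratio s k)) (proj₁ (proj₂ (inverse (0<ι (s ℕ.+ k))))) ⟩
  1ℚ * ((ι s - ι k) * ratio s k)                     ≡⟨ *-identityˡ _ ⟩
  (ι s - ι k) * ratio s k                            ∎
  where
  open ≡-Reasoning
  r = proj₁ (inverse (0<ι (s ℕ.+ k)))
  step : ∀ s k r t → (s + (1ℚ + k)) * ((s - k) * r * t) ≡ (1ℚ + (s + k)) * r * ((s - k) * t)
  step = solve-∀ ringℚ

0≤ratio : ∀ k L → 0ℚ ≤ ratio (k ℕ.+ L) k
0≤ratio zero L = 0≤1
0≤ratio (suc k) L =
  0≤* (0≤* (0≤difference (ι-mono (ℕ.≤-trans (ℕ.n≤1+n k) (ℕ.m≤m+n (suc k) L))))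
    (<⇒≤ (proj₂ (proj₂ (inverse (0<ι (suc (k ℕ.+ L) ℕ.+ k)))))))
    (subst (λ s → 0ℚ ≤ ratio s k) (ℕ.+-suc k L) (0≤ratio k (suc L)))

-- Passes from row 2s to row 2s - 2, where s = n + 1; the factor s² - k² is what dividing out the
-- node s² produces in `value-at-0`. Both rows are advanced in k by `ratio-suc`, after multiplying
-- by the denominator n + k + 1.
ratio-pred : ∀ n k → (ι (suc n) * ι (suc n) - ι k * ι k) * ratio (suc n) k ≡ ι (suc n) * ι (suc n) * ratio n k
ratio-pred n zero = step (ι n)
  where
  step : ∀ n → ((1ℚ + n) * (1ℚ + n) - 0ℚ * 0ℚ) * 1ℚ ≡ (1ℚ + n) * (1ℚ + n) * 1ℚ
  step = solve-∀ ringℚ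
ratio-pred n (suc k) = *-cancel-≡ (subst (0ℚ <_) (cong (1ℚ +_) (ι-+ n k)) (0<ι (n ℕ.+ k))) (begin
  (1ℚ + (N + K)) * ((S * S - K′ * K′) * t′)      ≡⟨ step₁ N K t′ ⟩
  (1ℚ + (N + K)) * ((N - K) * ((S + K′) * t′))   ≡⟨ cong (λ w → (1ℚ + (N + K)) * ((N - K) * w)) (ratio-suc (suc n) k) ⟩
  (1ℚ + (N + K)) * ((N - K) * ((S - K) * t))     ≡⟨ step₂ N K t ⟩
  (N - K) * ((S * S - K * K) * t)                ≡⟨ cong ((N - K) *_) (ratio-pred n k) ⟩
  (N - K) * (S * S * ratio n k)                  ≡⟨ step₃ N K (ratio n k) ⟩
  S * S * ((N - K) * ratio n k)                  ≡⟨ cong (S * S *_) (sym (ratio-suc n k)) ⟩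
  S * S * ((N + K′) * ratio n (suc k))           ≡⟨ step₄ N K (ratio n (suc k)) ⟩
  (1ℚ + (N + K)) * (S * S * ratio n (suc k))     ∎)
  where
  open ≡-Reasoning
  N = ι n
  S = ι (suc n)
  K = ι k
  K′ = ι (suc k)
  t = ratio (suc n) k
  t′ = ratio (suc n) (suc k)
  step₁ : ∀ n k t → (1ℚ + (n + k)) * (((1ℚ + n) * (1ℚ + n) - (1ℚ + k) * (1ℚ + k)) * t) ≡
                    (1ℚ + (n + k)) * ((n - k) * ((1ℚ + n + (1ℚ + k)) * t))
  step₁ = solve-∀ ringℚ
  step₂ : ∀ n k t → (1ℚ + (n + k)) * ((n - k) * ((1ℚ + n - k) * t)) ≡
                    (n - k) * (((1ℚ + n) * (1ℚ + n) - k * k) * t)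
  step₂ = solve-∀ ringℚ
  step₃ : ∀ n k t → (n - k) * ((1ℚ + n) * (1ℚ + n) * t) ≡ (1ℚ + n) * (1ℚ + n) * ((n - k) * t)
  step₃ = solve-∀ ringℚ
  step₄ : ∀ n k t → (1ℚ + n) * (1ℚ + n) * ((n + (1ℚ + k)) * t) ≡ (1ℚ + (n + k)) * ((1ℚ + n) * (1ℚ + n) * t)
  step₄ = solve-∀ ringℚ

-- An alternating tail of row 2s is a single coefficient of the row before, C(2s-1,s+m), here
-- divided by C(2s,s). For m = 0 this is `value-at-0` for the constant 1.
alternating-ratio-tail : ∀ s m L → m ℕ.+ L ≡ s →
  ι s * (2ℚ * alternating (ratio s) (suc m) L) ≡ (ι s - ι m) * ratio s m
alternating-ratio-tail s m zero eq rewrite trans (sym (ℕ.+-identityʳ m)) eq = step (ι s) (ratio s s)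
  where
  step : ∀ s t → s * (2ℚ * 0ℚ) ≡ (s - s) * t
  step = solve-∀ ringℚ
alternating-ratio-tail s m (suc L) eq = begin
  ι s * (2ℚ * (t′ - tail))                                ≡⟨ step₁ (ι s) t′ tail ⟩
  ι s * (2ℚ * t′) - ι s * (2ℚ * tail)                     ≡⟨ cong (λ w → ι s * (2ℚ * t′) - w) (alternating-ratio-tail s (suc m) L (trans (sym (ℕ.+-suc m L)) eq)) ⟩
  ι s * (2ℚ * t′) - (ι s - ι (suc m)) * t′                ≡⟨ step₂ (ι s) (ι m) t′ ⟩
  (ι s + ι (suc m)) * t′                                  ≡⟨ ratio-suc s m ⟩
  (ι s - ι m) * ratio s m                                 ∎
  where
  open ≡-Reasoning
  t′ = ratio s (suc m)
  tail = alternating (ratio s) (suc (suc m)) L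
  step₁ : ∀ s t a → s * (2ℚ * (t - a)) ≡ s * (2ℚ * t) - s * (2ℚ * a)
  step₁ = solve-∀ ringℚ
  step₂ : ∀ s m t → s * (2ℚ * t) - (s - (1ℚ + m)) * t ≡ (s + (1ℚ + m)) * t
  step₂ = solve-∀ ringℚ

-- A central difference of order 2s, written out on the nodes 0, 1, 4, …, s².
value-at-0 : ∀ s {g} → PolyLt s g → g 0ℚ ≡ 2ℚ * alternating (λ k → ratio s k * g (ι k * ι k)) 1 s
value-at-0 zero p = p 0ℚ
-- Divide out the last node: g y = g (s²) + (y - s²) v y with s = n + 1. The constant part is
-- settled by `total`; in the rest `ratio-pred` turns the weights of rank n + 1 into those of rank
-- n, where induction applies to v.
value-at-0 (suc n) {g} p with factor n p (ι (suc n) * ι (suc n))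
... | v , q , e = begin
  g 0ℚ                                                        ≡⟨ e 0ℚ ⟩
  c + (0ℚ - S²) * v 0ℚ                                        ≡⟨ cong (λ w → c + (0ℚ - S²) * w) (value-at-0 n q) ⟩
  c + (0ℚ - S²) * (2ℚ * b)                                    ≡⟨ cong (λ w → c + (0ℚ - S²) * (2ℚ * w)) (sym drop) ⟩
  c + (0ℚ - S²) * (2ℚ * b′)                                   ≡⟨ cong (_+ (0ℚ - S²) * (2ℚ * b′)) (trans (sym (*-identityʳ c)) (cong (c *_) (sym total))) ⟩
  c * (2ℚ * a) + (0ℚ - S²) * (2ℚ * b′)                        ≡⟨ step c (0ℚ - S²) a b′ ⟩
  2ℚ * (c * a + (0ℚ - S²) * b′)                               ≡⟨ cong (2ℚ *_) (sym (alternating-linear {a = c} {0ℚ - S²} split 1 (suc n))) ⟩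
  2ℚ * alternating (λ k → ratio (suc n) k * g (ι k * ι k)) 1 (suc n) ∎
  where
  open ≡-Reasoning
  S = ι (suc n)
  S² = S * S
  c = g S²
  a = alternating (ratio (suc n)) 1 (suc n)
  b = alternating (λ k → ratio n k * v (ι k * ι k)) 1 n
  b′ = alternating (λ k → ratio n k * v (ι k * ι k)) 1 (suc n)
  step : ∀ c d a b → c * (2ℚ * a) + d * (2ℚ * b) ≡ 2ℚ * (c * a + d * b)
  step = solve-∀ ringℚ
  total : 2ℚ * a ≡ 1ℚ
  total = *-cancel-≡ (0<ι n) (trans (alternating-ratio-tail (suc n) 0 (suc n) refl) (cong (_* 1ℚ) (+-identityʳ S)))
  zero-factor : ∀ x r t w → (x - x) * r * t * w ≡ 0ℚ
  zero-factor = solve-∀ ringℚ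
  -- The weight of rank n at k = n + 1 contains the factor n - n, so the extra term is zero.
  drop : b′ ≡ b
  drop = alternating-drop-last 1 n (zero-factor (ι n) (proj₁ (inverse (0<ι (n ℕ.+ n)))) (ratio n n) (v (S * S)))
  expand : ∀ t c x s w → t * (c + (x - s) * w) ≡ c * t + (0ℚ - 1ℚ) * ((s - x) * t * w)
  expand = solve-∀ ringℚ
  collect : ∀ t c s r w → c * t + (0ℚ - 1ℚ) * (s * r * w) ≡ c * t + (0ℚ - s) * (r * w)
  collect = solve-∀ ringℚ
  split : ∀ k → ratio (suc n) k * g (ι k * ι k) ≡ c * ratio (suc n) k + (0ℚ - S²) * (ratio n k * v (ι k * ι k))
  split k = begin
    ratio (suc n) k * g (ι k * ι k)                                  ≡⟨ cong (ratio (suc n) k *_) (e (ι k * ι k)) ⟩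
    ratio (suc n) k * (c + (ι k * ι k - S²) * w)                     ≡⟨ expand (ratio (suc n) k) c (ι k * ι k) S² w ⟩
    c * t + (0ℚ - 1ℚ) * ((S² - ι k * ι k) * t * w)                   ≡⟨ cong (λ z → c * t + (0ℚ - 1ℚ) * (z * w)) (ratio-pred n k) ⟩
    c * t + (0ℚ - 1ℚ) * (S² * ratio n k * w)                         ≡⟨ collect t c S² (ratio n k) w ⟩
    c * t + (0ℚ - S²) * (ratio n k * w)                              ∎
    where
    t = ratio (suc n) k
    w = v (ι k * ι k)

-- Decay of the weights at the nodes.

-- The trapezoidal rule overestimates the convex function x ↦ xⁿ; cleared of denominators.
trapezoid : ∀ {D v} → 0ℚ ≤ D → 0ℚ ≤ v → ∀ n →
  2ℚ * D * ((D + v) ^ℚ n - D ^ℚ n) ≤ ι n * v * ((D + v) ^ℚ n + D ^ℚ n)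
trapezoid {D} {v} 0≤D 0≤v zero = ≤-reflexive (step D v)
  where
  step : ∀ D v → 2ℚ * D * (1ℚ - 1ℚ) ≡ 0ℚ * v * (1ℚ + 1ℚ)
  step = solve-∀ ringℚ
trapezoid {D} {v} 0≤D 0≤v (suc n) =
  -- Twice the gap is (2D + v) times the inductive gap, plus v (n v (A - C) + 2 v A).
  *-cancel-≤ 0<2 (≤-slack (step D v A C (ι n))
    (0≤+ (0≤* (0≤* 0≤2 0≤D) 0≤e)
      (0≤* 0≤v (0≤+ (0≤+ 0≤e (0≤* (0≤* (0≤ι n) 0≤v) (0≤difference C≤A))) (0≤* (0≤* 0≤2 0≤v) 0≤A)))))
  where
  A = (D + v) ^ℚ n
  C = D ^ℚ n
  0≤A : 0ℚ ≤ A
  0≤A = 0≤^ (0≤+ 0≤D 0≤v) n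
  C≤A : C ≤ A
  C≤A = ^-mono 0≤D (≤-slack refl 0≤v) n
  0≤e : 0ℚ ≤ ι n * v * (A + C) - 2ℚ * D * (A - C)
  0≤e = 0≤difference (trapezoid 0≤D 0≤v n)
  step : ∀ D v A C m →
    2ℚ * (2ℚ * D * ((D + v) * A - D * C)) +
      (2ℚ * D * (m * v * (A + C) - 2ℚ * D * (A - C)) +
       v * (m * v * (A + C) - 2ℚ * D * (A - C) + m * v * (A - C) + 2ℚ * v * A)) ≡
    2ℚ * ((1ℚ + m) * v * ((D + v) * A + D * C))
  step = solve-∀ ringℚ

-- With A and C the n-th powers of D + v and D, the claim reads N (A - C) ≤ v (A + C). Since n N ≤
-- 2D, `trapezoid` gives n times this.
shift-power : ∀ {D v N} n → 0ℚ ≤ D → 0ℚ ≤ v → ι n * N ≤ 2ℚ * D →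
  (N - v) * (D + v) ^ℚ n ≤ (N + v) * D ^ℚ n
shift-power {D} {v} {N} zero 0≤D 0≤v _ = ≤-slack (step N v) (0≤* 0≤2 0≤v)
  where
  step : ∀ N v → (N - v) * 1ℚ + 2ℚ * v ≡ (N + v) * 1ℚ
  step = solve-∀ ringℚ
shift-power {D} {v} {N} (suc n) 0≤D 0≤v nN≤2D =
  *-cancel-≤ (0<ι n) (≤-slack (step D v N A C (ι (suc n)))
    (0≤+ (0≤difference (trapezoid 0≤D 0≤v (suc n)))
      (0≤* (0≤difference nN≤2D) (0≤difference (^-mono 0≤D (≤-slack refl 0≤v) (suc n))))))
  where
  A = (D + v) ^ℚ suc n
  C = D ^ℚ suc n
  step : ∀ D v N A C m →
    m * ((N - v) * A) + (m * v * (A + C) - 2ℚ * D * (A - C) + (2ℚ * D - m * N) * (A - C)) ≡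
    m * ((N + v) * C)
  step = solve-∀ ringℚ

-- The weights compensate the power that `homogenise` introduces. Let s = n + 1. From k to k + 1 the
-- base s² + k² grows by v = 2k + 1, while the ratio is multiplied by (N - v)/(N + v) with N = 2s +
-- 1; by `shift-power` the product does not grow.
ratio-power : ∀ n k L → k ℕ.+ L ≡ suc n →
  ratio (suc n) k * (ι (suc n) * ι (suc n) + ι k * ι k) ^ℚ n ≤ (ι (suc n) * ι (suc n)) ^ℚ n
ratio-power n zero L _ = ≤-reflexive (trans (*-identityˡ _) (cong (_^ℚ n) (step (ι (suc n) * ι (suc n)))))
  where
  step : ∀ s → s + 0ℚ * 0ℚ ≡ s
  step = solve-∀ ringℚ
ratio-power n (suc k) L eq = *-cancel-≤ (0<* 0<2 (0<+ (0<ι n) (0≤ι (suc k)))) (begin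
  2ℚ * (S + K′) * (r′ * (S * S + K′ * K′) ^ℚ n) ≡⟨ cong (λ w → 2ℚ * (S + K′) * (r′ * w ^ℚ n)) (node S K) ⟩
  2ℚ * (S + K′) * (r′ * A)                ≡⟨ step₁ (S + K′) r′ A ⟩
  2ℚ * ((S + K′) * r′) * A                ≡⟨ cong (λ w → 2ℚ * w * A) (ratio-suc (suc n) k) ⟩
  2ℚ * ((S - K) * r) * A                  ≡⟨ step₂ S K r A ⟩
  r * ((N - v) * A)                       ≤⟨ *-monoˡ 0≤r (shift-power n 0≤D 0≤v (≤-slack (step₃ (ι n) K) 0≤slack)) ⟩
  r * ((N + v) * C)                       ≡⟨ step₄ S K r C ⟩
  2ℚ * (S + K′) * (r * C)                 ≤⟨ *-monoˡ (0≤* 0≤2 (0≤+ (0≤ι (suc n)) (0≤ι (suc k)))) (ratio-power n k (suc L) (trans (ℕ.+-suc k L) eq)) ⟩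
  2ℚ * (S + K′) * (S * S) ^ℚ n            ∎)
  where
  open ≤-Reasoning
  S = ι (suc n)
  K = ι k
  K′ = ι (suc k)
  D = S * S + K * K
  v = 1ℚ + 2ℚ * K
  N = 1ℚ + 2ℚ * S
  A = (D + v) ^ℚ n
  C = D ^ℚ n
  r = ratio (suc n) k
  r′ = ratio (suc n) (suc k)
  0≤r : 0ℚ ≤ r
  0≤r = subst (λ s → 0ℚ ≤ ratio s k) (trans (ℕ.+-suc k L) eq) (0≤ratio k (suc L))
  0≤D : 0ℚ ≤ D
  0≤D = 0≤+ (0≤* (0≤ι (suc n)) (0≤ι (suc n))) (0≤* (0≤ι k) (0≤ι k))
  0≤v : 0ℚ ≤ v
  0≤v = 0≤+ 0≤1 (0≤* 0≤2 (0≤ι k))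
  0≤slack : 0ℚ ≤ ι n + 2ℚ + 2ℚ * (K * K)
  0≤slack = 0≤+ (0≤+ (0≤ι n) 0≤2) (0≤* 0≤2 (0≤* (0≤ι k) (0≤ι k)))
  node : ∀ s k → s * s + (1ℚ + k) * (1ℚ + k) ≡ s * s + k * k + (1ℚ + 2ℚ * k)
  node = solve-∀ ringℚ
  step₁ : ∀ x r a → 2ℚ * x * (r * a) ≡ 2ℚ * (x * r) * a
  step₁ = solve-∀ ringℚ
  step₂ : ∀ s k r a → 2ℚ * ((s - k) * r) * a ≡ r * ((1ℚ + 2ℚ * s - (1ℚ + 2ℚ * k)) * a)
  step₂ = solve-∀ ringℚ
  step₃ : ∀ m k → m * (1ℚ + 2ℚ * (1ℚ + m)) + (m + 2ℚ + 2ℚ * (k * k)) ≡ 2ℚ * ((1ℚ + m) * (1ℚ + m) + k * k)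
  step₃ = solve-∀ ringℚ
  step₄ : ∀ s k r c → r * ((1ℚ + 2ℚ * s + (1ℚ + 2ℚ * k)) * c) ≡ 2ℚ * (s + (1ℚ + k)) * (r * c)
  step₄ = solve-∀ ringℚ

-- Drop the subtracted terms; since 2/m² ≤ 1/(m−1) − 1/(m+1), the bounds on the others telescope.
-- Here m = j + 2 is the first rank of the sum, and the bound is multiplied by m − 1.
alternating-tail : ∀ {x : ℕ → ℚ} {s Y} → 0ℚ ≤ Y → (∀ k L → suc k ℕ.+ L ≡ s →
    0ℚ ≤ x (suc k) × ι (suc k) * ι (suc k) * x (suc k) ≤ Y * (ι s * ι s + ι (suc k) * ι (suc k))) →
  ∀ j L → suc j ℕ.+ L ≡ s →
  ι (suc j) * (2ℚ * alternating x (suc (suc j)) L) ≤ Y * (ι s * ι s + ι (suc j) * (1ℚ + ι L))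
alternating-tail {x} {s} {Y} 0≤Y bound j zero _ =
  ≤-slack (step (ι (suc j)) (Y * (ι s * ι s + ι (suc j) * (1ℚ + 0ℚ))))
    (0≤* 0≤Y (0≤+ (0≤* (0≤ι s) (0≤ι s)) (0≤* (0≤ι (suc j)) 0≤1)))
  where
  step : ∀ j d → j * (2ℚ * 0ℚ) + d ≡ d
  step = solve-∀ ringℚ
alternating-tail {x} {s} {Y} 0≤Y bound j (suc zero) eq =
  *-cancel-≤ (0<* (0<ι (suc j)) (0<ι (suc j)))
    (≤-slack (step (ι j) (x (suc (suc j))) Y (ι s * ι s))
      (0≤+ (0≤* (0≤* 0≤2 (0≤ι (suc j))) (0≤difference (proj₂ (bound (suc j) 0 (trans (sym (ℕ.+-suc (suc j) 0)) eq)))))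
        (0≤* (0≤* 0≤Y (0≤* (0≤ι s) (0≤ι s))) (0≤+ 0≤1 (0≤* (0≤ι (suc j)) (0≤ι (suc j)))))))
  where
  step : ∀ j a Y s → (1ℚ + (1ℚ + j)) * (1ℚ + (1ℚ + j)) * ((1ℚ + j) * (2ℚ * (a - 0ℚ))) +
      (2ℚ * (1ℚ + j) * (Y * (s + (1ℚ + (1ℚ + j)) * (1ℚ + (1ℚ + j))) - (1ℚ + (1ℚ + j)) * (1ℚ + (1ℚ + j)) * a) +
       Y * s * (1ℚ + (1ℚ + j) * (1ℚ + j))) ≡
    (1ℚ + (1ℚ + j)) * (1ℚ + (1ℚ + j)) * (Y * (s + (1ℚ + j) * (1ℚ + (1ℚ + 0ℚ))))
  step = solve-∀ ringℚ
-- Two terms at a time: the first is bounded, the second is dropped, the others are left to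
-- induction. After multiplication by m²(m² - 1), the summand `2ℚ * (Y * s)` is the slack in 2/m² ≤
-- 2/(m² - 1).
alternating-tail {x} {s} {Y} 0≤Y bound j (suc (suc L)) eq =
  *-cancel-≤ (0<* (0<* (0<ι (suc j)) (0<ι (suc j))) (0<ι (suc (suc j))))
    (≤-slack (step (ι j) (x (suc (suc j))) (x (suc (suc (suc j)))) (alternating x (4 ℕ.+ j) L) Y (ι s * ι s) (ι L))
      (0≤+ (0≤+ (0≤+
        (0≤* (0≤* (0≤* 0≤2 (0≤ι (suc j))) (0≤ι (3 ℕ.+ j))) (0≤difference (proj₂ first)))
        (0≤* (0≤* (0≤* (0≤ι (2 ℕ.+ j)) (0≤ι (2 ℕ.+ j))) (0≤ι (suc j))) (0≤difference later)))
        (0≤* (0≤* (0≤* (0≤* (0≤ι (2 ℕ.+ j)) (0≤ι (2 ℕ.+ j))) (0≤ι (3 ℕ.+ j))) (0≤ι (suc j))) (0≤* 0≤2 (proj₁ second))))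
        (0≤* 0≤2 (0≤* 0≤Y (0≤* (0≤ι s) (0≤ι s))))))
  where
  eq₁ : suc (suc j) ℕ.+ suc L ≡ s
  eq₁ = trans (sym (ℕ.+-suc (suc j) (suc L))) eq
  eq₂ : suc (suc (suc j)) ℕ.+ L ≡ s
  eq₂ = trans (sym (ℕ.+-suc (suc (suc j)) L)) eq₁
  first = bound (suc j) (suc L) eq₁
  second = bound (suc (suc j)) L eq₂
  later = alternating-tail 0≤Y bound (suc (suc j)) L eq₂
  step : ∀ j a b c Y s l → let m = 1ℚ + (1ℚ + j) in
    m * m * (1ℚ + m) * ((1ℚ + j) * (2ℚ * (a - (b - c)))) +
      (2ℚ * (1ℚ + j) * (1ℚ + m) * (Y * (s + m * m) - m * m * a) +
       m * m * (1ℚ + j) * (Y * (s + (1ℚ + m) * (1ℚ + l)) - (1ℚ + m) * (2ℚ * c)) +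
       m * m * (1ℚ + m) * (1ℚ + j) * (2ℚ * b) +
       2ℚ * (Y * s)) ≡
    m * m * (1ℚ + m) * (Y * (s + (1ℚ + j) * (1ℚ + (1ℚ + (1ℚ + l)))))
  step = solve-∀ ringℚ

-- A Markov inequality at the endpoint.

3ℚ : ℚ
3ℚ = 1ℚ + 2ℚ

-- Meant for u l = (B - g l)/l, where g 0 = B and g stays between -B and B on [0,1]; then u 0 =
-- -g′(0). With s = n + 1, `value-at-0` expands the homogenised u over the nodes k². There u l ≤
-- 2B/l = B (s² + k²)/k², and `ratio-power` cancels the power of s² + k².
markov : ∀ n {u B} → PolyLt (suc n) u → 0ℚ ≤ B →
  (∀ l → 0ℚ ≤ l → l ≤ 1ℚ → 0ℚ ≤ l * u l × l * u l ≤ 2ℚ * B) →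
  u 0ℚ ≤ (1ℚ + 3ℚ * (ι (suc n) * ι (suc n))) * B
markov n {u} {B} p 0≤B range with homogenise (ι (suc n) * ι (suc n)) n p
... | G , q , e = *-cancel-≤ (0<^ 0<σ n) (*-cancel-≤ 0<2 (begin
  2ℚ * (σ ^ℚ n * u 0ℚ)                    ≡⟨ cong (2ℚ *_) (sym G0) ⟩
  2ℚ * G 0ℚ                               ≡⟨ cong (2ℚ *_) (value-at-0 (suc n) q) ⟩
  2ℚ * (2ℚ * alternating x 1 (suc n))     ≤⟨ sum n refl ⟩
  2ℚ * ((1ℚ + 3ℚ * σ) * Y)                ≡⟨ regroup σ B (σ ^ℚ n) ⟩
  2ℚ * (σ ^ℚ n * ((1ℚ + 3ℚ * σ) * B))     ∎))
  where
  open ≤-Reasoning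
  S = ι (suc n)
  σ = S * S
  Y = B * σ ^ℚ n
  x : ℕ → ℚ
  x k = ratio (suc n) k * G (ι k * ι k)
  0<σ : 0ℚ < σ
  0<σ = 0<* (0<ι n) (0<ι n)
  0≤Y : 0ℚ ≤ Y
  0≤Y = 0≤* 0≤B (<⇒≤ (0<^ 0<σ n))
  zero-node : ∀ s → 0ℚ * (s + 0ℚ) ≡ 2ℚ * 0ℚ
  zero-node = solve-∀ ringℚ
  G0 : G 0ℚ ≡ σ ^ℚ n * u 0ℚ
  G0 = trans (e 0ℚ 0ℚ (zero-node σ)) (cong (λ w → w ^ℚ n * u 0ℚ) (+-identityʳ σ))
  regroup : ∀ s b w → 2ℚ * ((1ℚ + 3ℚ * s) * (b * w)) ≡ 2ℚ * (w * ((1ℚ + 3ℚ * s) * b))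
  regroup = solve-∀ ringℚ
  bound : ∀ k L → suc k ℕ.+ L ≡ suc n →
    0ℚ ≤ x (suc k) × ι (suc k) * ι (suc k) * x (suc k) ≤ Y * (S * S + ι (suc k) * ι (suc k))
  bound k L eq = 0≤* 0≤r 0≤G , (begin
    κ² * (r * G κ²)             ≡⟨ swap κ² r (G κ²) ⟩
    r * (κ² * G κ²)             ≤⟨ *-monoˡ 0≤r κ²G≤ ⟩
    r * (D * D ^ℚ n * B)        ≡⟨ swap′ r D (D ^ℚ n) B ⟩
    D * B * (r * D ^ℚ n)        ≤⟨ *-monoˡ (0≤* (<⇒≤ 0<D) 0≤B) (ratio-power n (suc k) L eq) ⟩
    D * B * σ ^ℚ n              ≡⟨ swap″ D B (σ ^ℚ n) ⟩
    Y * D                       ∎)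
    where
    κ = ι (suc k)
    κ² = κ * κ
    D = σ + κ²
    r = ratio (suc n) (suc k)
    0≤r : 0ℚ ≤ r
    0≤r = subst (λ s → 0ℚ ≤ ratio s (suc k)) eq (0≤ratio (suc k) L)
    0<κ² : 0ℚ < κ²
    0<κ² = 0<* (0<ι k) (0<ι k)
    0<D : 0ℚ < D
    0<D = 0<+ 0<σ (<⇒≤ 0<κ²)
    D⁻¹ = proj₁ (inverse 0<D)
    -- The point matched to the node y = κ² by l (σ + y) = 2y; it is at most 1 because κ ≤ S.
    l = 2ℚ * κ² * D⁻¹
    0<l : 0ℚ < l
    0<l = 0<* (0<* 0<2 0<κ²) (proj₂ (proj₂ (inverse 0<D)))
    assoc-swap : ∀ a b d → a * b * d ≡ a * (d * b)
    assoc-swap = solve-∀ ringℚ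
    lD : l * D ≡ 2ℚ * κ²
    lD = trans (assoc-swap (2ℚ * κ²) D⁻¹ D)
      (trans (cong (2ℚ * κ² *_) (proj₁ (proj₂ (inverse 0<D)))) (*-identityʳ _))
    κ≤S : κ ≤ S
    κ≤S = ι-mono (subst (suc k ℕ.≤_) eq (ℕ.m≤m+n (suc k) L))
    κ²≤σ : κ² ≤ σ
    κ²≤σ = ≤-trans (*-monoˡ (0≤ι (suc k)) κ≤S) (*-monoʳ (0≤ι (suc n)) κ≤S)
    double : ∀ a b → 2ℚ * a + (b - a) ≡ (b + a) * 1ℚ
    double = solve-∀ ringℚ
    l≤1 : l ≤ 1ℚ
    l≤1 = *-cancel-≤ 0<D (subst (_≤ D * 1ℚ) (trans (sym lD) (*-comm l D)) (≤-slack (double κ² σ) (0≤difference κ²≤σ)))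
    G≡ : G κ² ≡ D ^ℚ n * u l
    G≡ = e κ² l lD
    swap : ∀ a b c → a * (b * c) ≡ b * (a * c)
    swap = solve-∀ ringℚ
    swap′ : ∀ r d w b → r * (d * w * b) ≡ d * b * (r * w)
    swap′ = solve-∀ ringℚ
    swap″ : ∀ d b w → d * b * w ≡ b * w * d
    swap″ = solve-∀ ringℚ
    lG : D ^ℚ n * (l * u l) ≡ l * G κ²
    lG = trans (swap (D ^ℚ n) l (u l)) (cong (l *_) (sym G≡))
    0≤Dⁿ : 0ℚ ≤ D ^ℚ n
    0≤Dⁿ = <⇒≤ (0<^ 0<D n)
    0≤G : 0ℚ ≤ G κ²
    0≤G = *-cancel-≤ 0<l (subst₂ _≤_ (sym (*-zeroʳ l)) lG (0≤* 0≤Dⁿ (proj₁ (range l (<⇒≤ 0<l) l≤1))))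
    κ²G≤ : κ² * G κ² ≤ D * D ^ℚ n * B
    κ²G≤ = *-cancel-≤ 0<2 (begin
      2ℚ * (κ² * G κ²)          ≡⟨ sym (*-assoc 2ℚ κ² (G κ²)) ⟩
      2ℚ * κ² * G κ²            ≡⟨ cong (_* G κ²) (sym lD) ⟩
      l * D * G κ²              ≡⟨ move l D (G κ²) ⟩
      D * (l * G κ²)            ≡⟨ cong (D *_) (sym lG) ⟩
      D * (D ^ℚ n * (l * u l))  ≤⟨ *-monoˡ (<⇒≤ 0<D) (*-monoˡ 0≤Dⁿ (proj₂ (range l (<⇒≤ 0<l) l≤1))) ⟩
      D * (D ^ℚ n * (2ℚ * B))   ≡⟨ move′ D (D ^ℚ n) B ⟩
      2ℚ * (D * D ^ℚ n * B)     ∎)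
      where
      move : ∀ l d g → l * d * g ≡ d * (l * g)
      move = solve-∀ ringℚ
      move′ : ∀ d w b → d * (w * (2ℚ * b)) ≡ 2ℚ * (d * w * b)
      move′ = solve-∀ ringℚ
  sum : ∀ m → m ≡ n → 2ℚ * (2ℚ * alternating x 1 (suc m)) ≤ 2ℚ * ((1ℚ + 3ℚ * (ι (suc m) * ι (suc m))) * Y)
  sum zero refl = ≤-slack (step (x 1) Y) (0≤* (0≤* 0≤2 0≤2) (0≤difference (proj₂ (bound 0 0 refl))))
    where
    step : ∀ a Y → let o = 1ℚ + 0ℚ in
      2ℚ * (2ℚ * (a - 0ℚ)) + 2ℚ * 2ℚ * (Y * (o * o + o * o) - o * o * a) ≡ 2ℚ * ((1ℚ + 3ℚ * (o * o)) * Y)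
    step = solve-∀ ringℚ
  -- Rank 1 is bounded alone, rank 2 is subtracted and dropped, and `alternating-tail` with j = 1
  -- covers the ranks from 3 on. With s = m + 2, `Y * (s * m)` is the gap in 5s² + 2m + 6 ≤ 6s² + 2.
  sum (suc m) refl = ≤-slack (step (x 1) (x 2) (alternating x 3 m) Y (ι m))
    (0≤+ (0≤+ (0≤+ (0≤* (0≤* 0≤2 0≤2) (0≤difference (proj₂ (bound 0 (suc m) refl))))
      (0≤* (0≤* 0≤2 0≤2) (proj₁ (bound 1 m refl))))
      (0≤difference (alternating-tail 0≤Y bound 1 m refl)))
      (0≤* 0≤Y (0≤* (0≤ι (suc n)) (0≤ι m))))
    where
    step : ∀ a b c Y m → let o = 1ℚ + 0ℚ; s = 1ℚ + (1ℚ + m) in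
      2ℚ * (2ℚ * (a - (b - c))) +
        (2ℚ * 2ℚ * (Y * (s * s + o * o) - o * o * a) + 2ℚ * 2ℚ * b +
         (Y * (s * s + (1ℚ + o) * (1ℚ + m)) - (1ℚ + o) * (2ℚ * c)) + Y * (s * m)) ≡
      2ℚ * ((1ℚ + 3ℚ * (s * s)) * Y)
    step = solve-∀ ringℚ

-- Functions on the cube and their diagonal.

-- The coefficient of the first variable in the multilinear extension.
slice : ∀ {K} → (Vec Bool (suc K) → ℚ) → Vec Bool K → ℚ
slice g z = g (true ∷ z) - g (false ∷ z)

-- Degree below d of the multilinear polynomial interpolating g, read off one variable at a time.
DegLt : ∀ K → ℕ → (Vec Bool K → ℚ) → Set
DegLt K zero g = ∀ z → g z ≡ 0ℚ
DegLt zero (suc d) g = ⊤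
DegLt (suc K) (suc d) g = DegLt K (suc d) (g ∘ (false ∷_)) × DegLt K d (slice g)

DegLt-ext : ∀ K d {g h} → (∀ z → g z ≡ h z) → DegLt K d h → DegLt K d g
DegLt-ext K zero eq p z = trans (eq z) (p z)
DegLt-ext zero (suc d) eq p = tt
DegLt-ext (suc K) (suc d) eq (p , q) =
  DegLt-ext K (suc d) (eq ∘ (false ∷_)) p , DegLt-ext K d (λ z → cong₂ _-_ (eq (true ∷ z)) (eq (false ∷ z))) q

DegLt-0 : ∀ K d → DegLt K d (λ _ → 0ℚ)
DegLt-0 K zero z = refl
DegLt-0 zero (suc d) = tt
DegLt-0 (suc K) (suc d) = DegLt-0 K (suc d) , DegLt-ext K d (λ _ → +-inverseʳ 0ℚ) (DegLt-0 K d)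

DegLt-const : ∀ K d c → DegLt K (suc d) (λ _ → c)
DegLt-const zero d c = tt
DegLt-const (suc K) d c = DegLt-const K d c , DegLt-ext K d (λ _ → +-inverseʳ c) (DegLt-0 K d)

DegLt-suc : ∀ K d {g} → DegLt K d g → DegLt K (suc d) g
DegLt-suc K zero p = DegLt-ext K 1 p (DegLt-0 K 1)
DegLt-suc zero (suc d) p = tt
DegLt-suc (suc K) (suc d) (p , q) = DegLt-suc K (suc d) p , DegLt-suc K d q

DegLt-linear : ∀ K d a b {g h} → DegLt K d g → DegLt K d h → DegLt K d (λ z → a * g z + b * h z)
DegLt-linear K zero a b p q z = trans (cong₂ (λ u v → a * u + b * v) (p z) (q z)) (step a b)
  where
  step : ∀ a b → a * 0ℚ + b * 0ℚ ≡ 0ℚ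
  step = solve-∀ ringℚ
DegLt-linear zero (suc d) a b p q = tt
DegLt-linear (suc K) (suc d) a b {g} {h} (p , p′) (q , q′) =
  DegLt-linear K (suc d) a b p q ,
  DegLt-ext K d (λ z → step a b (g (true ∷ z)) (g (false ∷ z)) (h (true ∷ z)) (h (false ∷ z)))
    (DegLt-linear K d a b p′ q′)
  where
  step : ∀ a b u v w z → a * u + b * w - (a * v + b * z) ≡ a * (u - v) + b * (w - z)
  step = solve-∀ ringℚ

DegLt-at-true : ∀ K d {g : Vec Bool (suc K) → ℚ} → DegLt (suc K) d g → DegLt K d (g ∘ (true ∷_))
DegLt-at-true K zero p = p ∘ (true ∷_)
DegLt-at-true K (suc d) {g} (p , q) =
  DegLt-ext K (suc d) (λ z → step (g (true ∷ z)) (g (false ∷ z))) (DegLt-linear K (suc d) 1ℚ 1ℚ p (DegLt-suc K d q))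
  where
  step : ∀ u v → u ≡ 1ℚ * v + 1ℚ * (u - v)
  step = solve-∀ ringℚ

-- The multilinear extension of g at (l , … , l).
diagonal : ∀ K → (Vec Bool K → ℚ) → ℚ → ℚ
diagonal zero g l = g []
diagonal (suc K) g l = diagonal K (g ∘ (false ∷_)) l + l * diagonal K (slice g) l

diagonal-linear : ∀ K a b {f} (g h : Vec Bool K → ℚ) → (∀ z → f z ≡ a * g z + b * h z) →
  ∀ l → diagonal K f l ≡ a * diagonal K g l + b * diagonal K h l
diagonal-linear zero a b g h eq l = eq []
diagonal-linear (suc K) a b g h eq l =
  trans (cong₂ (λ u v → u + l * v)
      (diagonal-linear K a b (g ∘ (false ∷_)) (h ∘ (false ∷_)) (eq ∘ (false ∷_)) l)
      (diagonal-linear K a b (slice g) (slice h)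
        (λ z → trans (cong₂ _-_ (eq (true ∷ z)) (eq (false ∷ z)))
           (rearrange a b (g (true ∷ z)) (g (false ∷ z)) (h (true ∷ z)) (h (false ∷ z)))) l))
    (step a b l (diagonal K (g ∘ (false ∷_)) l) (diagonal K (slice g) l)
      (diagonal K (h ∘ (false ∷_)) l) (diagonal K (slice h) l))
  where
  rearrange : ∀ a b u v w z → a * u + b * w - (a * v + b * z) ≡ a * (u - v) + b * (w - z)
  rearrange = solve-∀ ringℚ
  step : ∀ a b l u v w z → a * u + b * w + l * (a * v + b * z) ≡ a * (u + l * v) + b * (w + l * z)
  step = solve-∀ ringℚ

diagonal-vanishes : ∀ K {g} → (∀ z → g z ≡ 0ℚ) → ∀ l → diagonal K g l ≡ 0ℚ
diagonal-vanishes K {g} p l = trans (diagonal-linear K 0ℚ 0ℚ g g (λ z → trans (p z) (zeros (g z))) l) (sym (zeros (diagonal K g l)))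
  where
  zeros : ∀ x → 0ℚ ≡ 0ℚ * x + 0ℚ * x
  zeros = solve-∀ ringℚ

diagonal-at-0 : ∀ K g → diagonal K g 0ℚ ≡ g (replicate K false)
diagonal-at-0 zero g = refl
diagonal-at-0 (suc K) g =
  trans (cong₂ _+_ (diagonal-at-0 K (g ∘ (false ∷_))) (*-zeroˡ (diagonal K (slice g) 0ℚ))) (+-identityʳ _)

diagonal-poly : ∀ K d {g} → DegLt K d g → PolyLt d (diagonal K g)
diagonal-poly K zero p = diagonal-vanishes K p
diagonal-poly zero (suc d) {g} p = PolyLt-const d (g [])
diagonal-poly (suc K) (suc d) {g} (p , q) =
  PolyLt-ext (suc d) (λ l → step (diagonal K (g ∘ (false ∷_)) l) l (diagonal K (slice g) l))
    (PolyLt-+ (suc d) (diagonal-poly K (suc d) p) (PolyLt-linear d 0ℚ 1ℚ (diagonal-poly K d q)))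
  where
  step : ∀ u l v → u + l * v ≡ u + (0ℚ + 1ℚ * l) * v
  step = solve-∀ ringℚ

-- For l in [0,1] the diagonal is a weighted mean of values of g: the parts with first bit `false`
-- and `true` enter with weights 1 - l and l.
diagonal-≤ : ∀ K {g B} → (∀ z → g z ≤ B) → ∀ {l} → 0ℚ ≤ l → l ≤ 1ℚ → diagonal K g l ≤ B
diagonal-≤ zero p _ _ = p []
diagonal-≤ (suc K) {g} {B} p {l} 0≤l l≤1 =
  ≤-slack (trans (cong (λ w → g₀ + l * w + slack) (diagonal-linear K 1ℚ (- 1ℚ) (g ∘ (true ∷_)) (g ∘ (false ∷_)) (λ z → difference (g (true ∷ z)) (g (false ∷ z))) l)) (step B l g₀ g₁))
    (0≤+ (0≤* (0≤difference l≤1) (0≤difference (diagonal-≤ K (p ∘ (false ∷_)) 0≤l l≤1)))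
      (0≤* 0≤l (0≤difference (diagonal-≤ K (p ∘ (true ∷_)) 0≤l l≤1))))
  where
  g₀ = diagonal K (g ∘ (false ∷_)) l
  g₁ = diagonal K (g ∘ (true ∷_)) l
  slack = (1ℚ - l) * (B - g₀) + l * (B - g₁)
  difference : ∀ u v → u - v ≡ 1ℚ * u + (- 1ℚ) * v
  difference = solve-∀ ringℚ
  step : ∀ B l u v → u + l * (1ℚ * v + (- 1ℚ) * u) + ((1ℚ - l) * (B - u) + l * (B - v)) ≡ B
  step = solve-∀ ringℚ

-- Bounding the number of sign-changing flips.

-- Negativity at every point with exactly one bit set; the recursion fixes the earlier bits to
-- `false`.
FlipsNegative : ∀ K → (Vec Bool K → ℚ) → Set
FlipsNegative zero g = ⊤
FlipsNegative (suc K) g = g (true ∷ replicate K false) < 0ℚ × FlipsNegative K (g ∘ (false ∷_))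

-- h is the difference quotient at 0, and `h 0ℚ` the slope: the sum over i of g at the i-th unit
-- vector minus g at the origin, each summand being below -g at the origin. The weak bound starts
-- the induction, since K = 0 gives equality.
diagonal-slope : ∀ K d {g} → DegLt K (suc d) g → FlipsNegative K g →
  ∃ λ h → PolyLt d h × (∀ l → diagonal K g l ≡ g (replicate K false) + l * h l) ×
    ι K * g (replicate K false) + h 0ℚ ≤ 0ℚ × (0 ℕ.< K → ι K * g (replicate K false) + h 0ℚ < 0ℚ)
diagonal-slope zero d {g} p _ = (λ _ → 0ℚ) , PolyLt-0 d , (λ l → step l (g [])) , ≤-reflexive (step′ (g [])) , λ ()
  where
  step : ∀ l c → c ≡ c + l * 0ℚ
  step = solve-∀ ringℚ
  step′ : ∀ c → 0ℚ * c + 0ℚ ≡ 0ℚ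
  step′ = solve-∀ ringℚ
diagonal-slope (suc K) d {g} (p , q) (flip , flips) with diagonal-slope K d p flips
... | h , r , e , ≤0 , _ =
  (λ l → h l + diagonal K (slice g) l) , PolyLt-+ d r (diagonal-poly K d q) ,
  (λ l → trans (cong (_+ l * diagonal K (slice g) l) (e l)) (step c l (h l) (diagonal K (slice g) l))) ,
  <⇒≤ negative , λ _ → negative
  where
  c = g (replicate (suc K) false)
  c′ = g (true ∷ replicate K false)
  step : ∀ c l u v → c + l * u + l * v ≡ c + l * (u + v)
  step = solve-∀ ringℚ
  regroup : ∀ k c c′ u → k * c + u + c′ ≡ (1ℚ + k) * c + (u + (c′ - c))
  regroup = solve-∀ ringℚ
  negative : ι (suc K) * c + (h 0ℚ + diagonal K (slice g) 0ℚ) < 0ℚ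
  negative = subst₂ _<_
    (trans (regroup (ι K) c c′ (h 0ℚ)) (cong (λ w → ι (suc K) * c + (h 0ℚ + w)) (sym (diagonal-at-0 K (slice g)))))
    (+-identityʳ 0ℚ) (+-mono-≤-< ≤0 flip)

-- With u = -h and B the value at the origin, K B < u 0 ≤ (1 + 3s²) B for positive K and s. As K is
-- an integer, strictness absorbs the 1.
flips-bound : ∀ K s {g} → DegLt K (suc s) g → FlipsNegative K g → 0ℚ < g (replicate K false) →
  (∀ z → g z ≤ g (replicate K false)) → (∀ z → - g z ≤ g (replicate K false)) → K ℕ.≤ 3 ℕ.* (s ℕ.* s)
flips-bound zero s _ _ _ _ _ = ℕ.z≤n
flips-bound (suc K) s {g} p flips 0<B upper lower = conclude s (proj₁ (proj₂ slope))
  where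
  slope = diagonal-slope (suc K) s {g} p flips
  h = proj₁ slope
  e = proj₁ (proj₂ (proj₂ slope))
  steep = proj₂ (proj₂ (proj₂ (proj₂ slope)))
  B = g (replicate (suc K) false)
  u : ℚ → ℚ
  u l = (- 1ℚ) * h l
  0≤B = <⇒≤ 0<B
  conclude : ∀ s → PolyLt s h → suc K ℕ.≤ 3 ℕ.* (s ℕ.* s)
  -- For s = 0 the difference quotient vanishes, and the strict slope bound would make a nonnegative
  -- number negative.
  conclude zero q = ⊥-elim (<-irrefl refl (≤-<-trans (0≤* (0≤ι (suc K)) 0≤B)
    (subst (_< 0ℚ) (trans (cong (ι (suc K) * B +_) (q 0ℚ)) (+-identityʳ _)) (steep (ℕ.s≤s ℕ.z≤n)))))
  conclude (suc n) q = ℕ.≮⇒≥ λ large → <-irrefl refl (<-≤-trans below (≤-trans (markov n (PolyLt-scale (suc n) (- 1ℚ) {h} q) 0≤B range) (above large)))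
    where
    S² = ι (suc n) * ι (suc n)
    k = 3 ℕ.* (suc n ℕ.* suc n)
    cancel : ∀ a h → a + h + (- 1ℚ) * h ≡ a
    cancel = solve-∀ ringℚ
    below : ι (suc K) * B < u 0ℚ
    below = subst₂ _<_ (cancel (ι (suc K) * B) (h 0ℚ)) (+-identityˡ (u 0ℚ)) (+-monoˡ-< (u 0ℚ) (steep (ℕ.s≤s ℕ.z≤n)))
    cube : ι k ≡ 3ℚ * S²
    cube = trans (ι-* 3 (suc n ℕ.* suc n)) (cong (3ℚ *_) (ι-* (suc n) (suc n)))
    above : k ℕ.< suc K → (1ℚ + 3ℚ * S²) * B ≤ ι (suc K) * B
    above large = *-monoʳ 0≤B (subst (λ w → 1ℚ + w ≤ ι (suc K)) cube (ι-mono large))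
    range : ∀ l → 0ℚ ≤ l → l ≤ 1ℚ → 0ℚ ≤ l * u l × l * u l ≤ 2ℚ * B
    -- `l * u l` is B minus the diagonal of g at l, which lies between -B and B.
    range l 0≤l l≤1 =
      subst (0ℚ ≤_) (trans (cong (λ w → B - w) (e l)) (drop B l (h l))) (0≤difference (diagonal-≤ (suc K) {g} upper 0≤l l≤1)) ,
      ≤-slack (trans (cong (λ w → l * u l + (B - w)) opposite) (drop′ B l (h l))) (0≤difference (diagonal-≤ (suc K) {λ z → - g z} lower 0≤l l≤1))
      where
      drop : ∀ B l h → B - (B + l * h) ≡ l * ((- 1ℚ) * h)
      drop = solve-∀ ringℚ
      negate : ∀ x → - x ≡ (- 1ℚ) * x + 0ℚ * x
      negate = solve-∀ ringℚ
      opposite : diagonal (suc K) (λ z → - g z) l ≡ (- 1ℚ) * (B + l * h l) + 0ℚ * (B + l * h l)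
      opposite = trans (diagonal-linear (suc K) (- 1ℚ) 0ℚ g g (λ z → negate (g z)) l)
        (cong (λ w → (- 1ℚ) * w + 0ℚ * w) (e l))
      drop′ : ∀ B l h → l * ((- 1ℚ) * h) + (B - ((- 1ℚ) * (B + l * h) + 0ℚ * (B + l * h))) ≡ 2ℚ * B
      drop′ = solve-∀ ringℚ

-- Evaluation of multilinear polynomials.

sumOver : ∀ {A : Set} → (A → ℚ) → List A → ℚ
sumOver F = foldr (λ S acc → F S + acc) 0ℚ

sumOver-++ : ∀ {A : Set} (F : A → ℚ) xs ys → sumOver F (xs List.++ ys) ≡ sumOver F xs + sumOver F ys
sumOver-++ F [] ys = sym (+-identityˡ _)
sumOver-++ F (x ∷ xs) ys = trans (cong (F x +_) (sumOver-++ F xs ys)) (sym (+-assoc (F x) _ _))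

sumOver-map : ∀ {A B : Set} (F : B → ℚ) (G : A → ℚ) c (h : A → B) → (∀ S → F (h S) ≡ c * G S) →
  ∀ xs → sumOver F (List.map h xs) ≡ c * sumOver G xs
sumOver-map F G c h eq [] = sym (*-zeroʳ c)
sumOver-map F G c h eq (x ∷ xs) =
  trans (cong₂ _+_ (eq x) (sumOver-map F G c h eq xs)) (sym (*-distribˡ-+ c (G x) (sumOver G xs)))

eval-∷ : ∀ {n} (p : MLPoly (suc n)) b x →
  eval p (b ∷ x) ≡ eval (p ∘ (false ∷_)) x + bitℚ b * eval (p ∘ (true ∷_)) x
eval-∷ {n} p b x = trans (sumOver-++ F (List.map (false ∷_) L) (List.map (true ∷_) L))
  (cong₂ _+_
    (trans (sumOver-map F F₀ 1ℚ (false ∷_) (λ S → sym (*-identityˡ (F₀ S))) L) (*-identityˡ (sumOver F₀ L)))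
    (sumOver-map F F₁ (bitℚ b) (true ∷_) (λ S → swap (p (true ∷ S)) (bitℚ b) (monomial S x)) L))
  where
  L = allSubsets n
  F = λ S → p S * monomial S (b ∷ x)
  F₀ = λ S → p (false ∷ S) * monomial S x
  F₁ = λ S → p (true ∷ S) * monomial S x
  swap : ∀ a b c → a * (b * c) ≡ b * (a * c)
  swap = solve-∀ ringℚ

eval-[] : ∀ (p : MLPoly 0) → eval p [] ≡ p []
eval-[] p = step (p [])
  where
  step : ∀ a → a * 1ℚ + 0ℚ ≡ a
  step = solve-∀ ringℚ

eval-linear : ∀ {n} a b {p : MLPoly n} (q r : MLPoly n) → (∀ S → p S ≡ a * q S + b * r S) →
  ∀ x → eval p x ≡ a * eval q x + b * eval r x
eval-linear a b {p} q r eq [] =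
  trans (eval-[] p) (trans (eq []) (cong₂ (λ u v → a * u + b * v) (sym (eval-[] q)) (sym (eval-[] r))))
eval-linear a b {p} q r eq (c ∷ x) = begin
  eval p (c ∷ x)                                           ≡⟨ eval-∷ p c x ⟩
  eval (p ∘ (false ∷_)) x + bitℚ c * eval (p ∘ (true ∷_)) x
    ≡⟨ cong₂ (λ u v → u + bitℚ c * v) (eval-linear a b (q ∘ (false ∷_)) (r ∘ (false ∷_)) (eq ∘ (false ∷_)) x)
         (eval-linear a b (q ∘ (true ∷_)) (r ∘ (true ∷_)) (eq ∘ (true ∷_)) x) ⟩
  a * q₀ + b * r₀ + bitℚ c * (a * q₁ + b * r₁)              ≡⟨ step a b (bitℚ c) q₀ q₁ r₀ r₁ ⟩
  a * (q₀ + bitℚ c * q₁) + b * (r₀ + bitℚ c * r₁)           ≡⟨ cong₂ (λ u v → a * u + b * v) (sym (eval-∷ q c x)) (sym (eval-∷ r c x)) ⟩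
  a * eval q (c ∷ x) + b * eval r (c ∷ x)                   ∎
  where
  open ≡-Reasoning
  q₀ = eval (q ∘ (false ∷_)) x
  q₁ = eval (q ∘ (true ∷_)) x
  r₀ = eval (r ∘ (false ∷_)) x
  r₁ = eval (r ∘ (true ∷_)) x
  step : ∀ a b c u v w z → a * u + b * w + c * (a * v + b * z) ≡ a * (u + c * v) + b * (w + c * z)
  step = solve-∀ ringℚ

eval-vanishes : ∀ {n} (p : MLPoly n) → (∀ S → p S ≡ 0ℚ) → ∀ x → eval p x ≡ 0ℚ
eval-vanishes p eq x =
  trans (eval-linear 0ℚ 0ℚ p p (λ S → trans (eq S) (zeros (p S))) x) (sym (zeros (eval p x)))
  where
  zeros : ∀ x → 0ℚ ≡ 0ℚ * x + 0ℚ * x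
  zeros = solve-∀ ringℚ

nonzero-summand : ∀ a {u v} → u + a * v ≢ 0ℚ → u ≢ 0ℚ ⊎ v ≢ 0ℚ
nonzero-summand a {u} {v} ne with u ≟ 0ℚ | v ≟ 0ℚ
... | no u≢0 | _ = inj₁ u≢0
... | yes _ | no v≢0 = inj₂ v≢0
... | yes refl | yes refl = ⊥-elim (ne (trans (+-identityˡ (a * 0ℚ)) (*-zeroʳ a)))

fixHead : ∀ {n} → Bool → MLPoly (suc n) → MLPoly n
fixHead b p S = p (false ∷ S) + bitℚ b * p (true ∷ S)

eval-fixHead : ∀ {n} b (p : MLPoly (suc n)) x → eval (fixHead b p) x ≡ eval p (b ∷ x)
eval-fixHead b p x = begin
  eval (fixHead b p) x                ≡⟨ eval-linear 1ℚ (bitℚ b) p₀ p₁ (λ S → cong (_+ bitℚ b * p₁ S) (sym (*-identityˡ (p₀ S)))) x ⟩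
  1ℚ * eval p₀ x + bitℚ b * eval p₁ x ≡⟨ cong (_+ bitℚ b * eval p₁ x) (*-identityˡ (eval p₀ x)) ⟩
  eval p₀ x + bitℚ b * eval p₁ x      ≡⟨ sym (eval-∷ p b x) ⟩
  eval p (b ∷ x)                      ∎
  where
  open ≡-Reasoning
  p₀ = p ∘ (false ∷_)
  p₁ = p ∘ (true ∷_)

-- DegLe with a strict bound, so that 0 describes the zero polynomial.
CoeffLt : ∀ {n} → MLPoly n → ℕ → Set
CoeffLt p d = ∀ S → p S ≢ 0ℚ → weight S ℕ.< d

-- All that `eval-DegLt` asks of a substituted bit: it behaves like a factor of degree at most one.
Multiplier : ∀ K → (Vec Bool K → ℚ) → Set
Multiplier K h = ∀ d {g} → DegLt K d g → DegLt K (suc d) (λ z → h z * g z)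

-- Write p = p₀ + X p₁ with X the first variable. The bound for p₁ is one lower, and multiplying by
-- the bit substituted for X restores it.
eval-DegLt : ∀ {n K} (p : MLPoly n) d → CoeffLt p d → (w : Vec Bool K → Input n) →
  (∀ j → Multiplier K (λ z → bitℚ (lookup (w z) j))) → DegLt K d (λ z → eval p (w z))
eval-DegLt {K = K} p zero small w mult z = eval-vanishes p (λ S → decidable-stable (p S ≟ 0ℚ) (λ ne → ℕ.n≮0 (small S ne))) (w z)
eval-DegLt {zero} {K} p (suc d) small w mult =
  DegLt-ext K (suc d) (λ z → constant (w z)) (DegLt-const K d (p []))
  where
  constant : ∀ x → eval p x ≡ p []
  constant [] = eval-[] p
eval-DegLt {suc n} {K} p (suc d) small w mult =
  DegLt-ext K (suc d) expand
    (DegLt-linear K (suc d) 1ℚ 1ℚ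
      (eval-DegLt (p ∘ (false ∷_)) (suc d) (λ S → small (false ∷ S)) (rest ∘ w) mult′)
      (mult zero d (eval-DegLt (p ∘ (true ∷_)) d (λ S ne → ℕ.s≤s⁻¹ (small (true ∷ S) ne)) (rest ∘ w) mult′)))
  where
  rest : Input (suc n) → Input n
  rest (_ ∷ x) = x
  lookup-rest : ∀ x j → lookup (rest x) j ≡ lookup x (suc j)
  lookup-rest (_ ∷ x) j = refl
  mult′ : ∀ j → Multiplier K (λ z → bitℚ (lookup (rest (w z)) j))
  mult′ j e {g} q = DegLt-ext K (suc e) (λ z → cong (λ b → bitℚ b * g z) (lookup-rest (w z) j)) (mult (suc j) e q)
  expand-∷ : ∀ x → eval p x ≡ 1ℚ * eval (p ∘ (false ∷_)) (rest x) + 1ℚ * (bitℚ (lookup x zero) * eval (p ∘ (true ∷_)) (rest x))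
  expand-∷ (b ∷ x) = trans (eval-∷ p b x) (sym (cong₂ _+_ (*-identityˡ (eval (p ∘ (false ∷_)) x)) (*-identityˡ (bitℚ b * eval (p ∘ (true ∷_)) x))))
  expand : ∀ z → eval p (w z) ≡ 1ℚ * eval (p ∘ (false ∷_)) (rest (w z)) + 1ℚ * (bitℚ (lookup (w z) zero) * eval (p ∘ (true ∷_)) (rest (w z)))
  expand z = expand-∷ (w z)

-- Fixing a variable.

-- The result stays in n variables, without any monomial containing the fixed one, so the indices
-- queried by a decision tree need no renaming.
restrict : ∀ {n} → Fin n → Bool → MLPoly n → MLPoly n
restrict zero b p (true ∷ S) = 0ℚ
restrict zero b p (false ∷ S) = fixHead b p S
restrict (suc i) b p (c ∷ S) = restrict i b (p ∘ (c ∷_)) S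

eval-restrict : ∀ {n} (i : Fin n) b (p : MLPoly n) x → eval (restrict i b p) x ≡ eval p (x [ i ]≔ b)
eval-restrict {suc n} zero b p (c ∷ x) = begin
  eval (restrict zero b p) (c ∷ x)             ≡⟨ eval-∷ (restrict zero b p) c x ⟩
  eval (fixHead b p) x + bitℚ c * eval zeros x ≡⟨ cong (λ w → eval (fixHead b p) x + bitℚ c * w) (eval-vanishes zeros (λ _ → refl) x) ⟩
  eval (fixHead b p) x + bitℚ c * 0ℚ           ≡⟨ cong (eval (fixHead b p) x +_) (*-zeroʳ (bitℚ c)) ⟩
  eval (fixHead b p) x + 0ℚ                    ≡⟨ +-identityʳ (eval (fixHead b p) x) ⟩
  eval (fixHead b p) x                         ≡⟨ eval-fixHead b p x ⟩
  eval p (b ∷ x)                               ∎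
  where
  open ≡-Reasoning
  zeros : MLPoly n
  zeros _ = 0ℚ
eval-restrict (suc i) b p (c ∷ x) =
  trans (eval-∷ (restrict (suc i) b p) c x)
    (trans (cong₂ (λ u v → u + bitℚ c * v) (eval-restrict i b (p ∘ (false ∷_)) x) (eval-restrict i b (p ∘ (true ∷_)) x))
      (sym (eval-∷ p c (x [ i ]≔ b))))

restrict-nonzero : ∀ {n} (i : Fin n) b (p : MLPoly n) S → restrict i b p S ≢ 0ℚ →
  lookup S i ≡ false × (p S ≢ 0ℚ ⊎ p (S [ i ]≔ true) ≢ 0ℚ)
restrict-nonzero zero b p (true ∷ S) ne = ⊥-elim (ne refl)
restrict-nonzero zero b p (false ∷ S) ne = refl , nonzero-summand (bitℚ b) ne
restrict-nonzero (suc i) b p (c ∷ S) ne = restrict-nonzero i b (p ∘ (c ∷_)) S ne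

weight-insert : ∀ {n} (S : Vec Bool n) i → lookup S i ≡ false → weight (S [ i ]≔ true) ≡ suc (weight S)
weight-insert (false ∷ S) zero eq = refl
weight-insert (true ∷ S) (suc i) eq = cong suc (weight-insert S i eq)
weight-insert (false ∷ S) (suc i) eq = weight-insert S i eq

restrict-DegLe : ∀ {n} (i : Fin n) b {p : MLPoly n} {d} → DegLe p d → DegLe (restrict i b p) d
restrict-DegLe i b {p} {d} deg S ne with restrict-nonzero i b p S ne
... | _ , inj₁ ne′ = deg S ne′
... | out , inj₂ ne′ = ℕ.≤-trans (ℕ.n≤1+n _) (subst (ℕ._≤ d) (weight-insert S i out) (deg _ ne′))

-- Monomials of top degree.

overwrite : ∀ {n} → Vec Bool n → Input n → Input n → Input n
overwrite [] [] [] = []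
overwrite (true ∷ M) (b ∷ y) (c ∷ x) = b ∷ overwrite M y x
overwrite (false ∷ M) (b ∷ y) (c ∷ x) = c ∷ overwrite M y x

lookup-overwrite : ∀ {n} (M : Vec Bool n) y x j →
  lookup (overwrite M y x) j ≡ (if lookup M j then lookup y j else lookup x j)
lookup-overwrite (true ∷ M) (b ∷ y) (c ∷ x) zero = refl
lookup-overwrite (false ∷ M) (b ∷ y) (c ∷ x) zero = refl
lookup-overwrite (true ∷ M) (b ∷ y) (c ∷ x) (suc j) = lookup-overwrite M y x j
lookup-overwrite (false ∷ M) (b ∷ y) (c ∷ x) (suc j) = lookup-overwrite M y x j

-- Fix the variables outside M as in x. As M has top degree, no larger monomial collapses onto it
-- and its coefficient survives; a multilinear polynomial with a nonzero coefficient is nonzero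
-- somewhere on the cube.
nonzero-inside-maxonomial : ∀ {n} (p : MLPoly n) d → DegLe p d → ∀ M → weight M ≡ d → p M ≢ 0ℚ →
  ∀ x → ∃ λ y → eval p (overwrite M y x) ≢ 0ℚ
nonzero-inside-maxonomial p d deg [] wt ne [] = [] , λ eq → ne (trans (sym (eval-[] p)) eq)
nonzero-inside-maxonomial p (suc d) deg (true ∷ M) wt ne (c ∷ x)
  with nonzero-inside-maxonomial (p ∘ (true ∷_)) d (λ S ne′ → ℕ.s≤s⁻¹ (deg (true ∷ S) ne′)) M (ℕ.suc-injective wt) ne x
... | y , ne₁ with eval p (false ∷ overwrite M y x) ≟ 0ℚ
...   | no ne₀ = false ∷ y , ne₀
-- The coefficient of the first variable is the difference of the two values of p, and by `ne₁` it
-- is nonzero at v, so both values cannot vanish.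
...   | yes eq₀ = true ∷ y , λ eq → ne₁ (begin
  e₁                                           ≡⟨ step e₀ e₁ ⟩
  e₀ + 1ℚ * e₁ - (e₀ + 0ℚ * e₁)                ≡⟨ cong₂ _-_ (sym (eval-∷ p true v)) (sym (eval-∷ p false v)) ⟩
  eval p (true ∷ v) - eval p (false ∷ v)       ≡⟨ cong₂ _-_ eq eq₀ ⟩
  0ℚ                                           ∎)
  where
  open ≡-Reasoning
  v = overwrite M y x
  e₀ = eval (p ∘ (false ∷_)) v
  e₁ = eval (p ∘ (true ∷_)) v
  step : ∀ a b → b ≡ a + 1ℚ * b - (a + 0ℚ * b)
  step = solve-∀ ringℚ
nonzero-inside-maxonomial p d deg (false ∷ M) wt ne (c ∷ x) =
  false ∷ proj₁ found , λ eq → proj₂ found (trans (eval-fixHead c p (overwrite M (proj₁ found) x)) eq)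
  where
  deg′ : DegLe (fixHead c p) d
  deg′ S ne′ with nonzero-summand (bitℚ c) ne′
  ... | inj₁ ne₀ = deg (false ∷ S) ne₀
  ... | inj₂ ne₁ = ℕ.≤-trans (ℕ.n≤1+n _) (deg (true ∷ S) ne₁)
  -- The only coefficient that could be added to that of M; its monomial would have degree d + 1.
  above : p (true ∷ M) ≡ 0ℚ
  above = decidable-stable (p (true ∷ M) ≟ 0ℚ) (λ ne₁ → ℕ.1+n≰n (subst (λ k → suc k ℕ.≤ d) wt (deg (true ∷ M) ne₁)))
  same : fixHead c p M ≡ p (false ∷ M)
  same = trans (cong (λ w → p (false ∷ M) + bitℚ c * w) above)
    (trans (cong (p (false ∷ M) +_) (*-zeroʳ (bitℚ c))) (+-identityʳ (p (false ∷ M))))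
  found = nonzero-inside-maxonomial (fixHead c p) d deg′ M wt (λ eq → ne (trans (sym same) eq)) x

-- Disjoint blocks flipped independently.

Meets : ∀ {n} → Vec Bool n → Vec Bool n → Set
Meets S M = ∃ λ j → lookup S j ≡ true × lookup M j ≡ true

meets? : ∀ {n} (S M : Vec Bool n) → Dec (Meets S M)
meets? S M = any? λ j → (lookup S j ≟ᵇ true) ×-dec (lookup M j ≟ᵇ true)

Disjoint : ∀ {n} → Vec Bool n → Vec Bool n → Set
Disjoint S M = ¬ Meets S M

mixture : ∀ {n} {R : Vec Bool n → Input n → Set} {F} → Input n →
  All (λ M → ∃ (R M)) F → Vec Bool (length F) → Input n
mixture x [] [] = x
mixture x (_∷_ {x = M} (y , _) ys) (b ∷ z) = if b then overwrite M y (mixture x ys z) else mixture x ys z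

module _ {n} {R : Vec Bool n → Input n → Set} (x : Input n) where

  mixture-zeros : ∀ {F} (ys : All (λ M → ∃ (R M)) F) → mixture x ys (replicate (length F) false) ≡ x
  mixture-zeros [] = refl
  mixture-zeros (y ∷ ys) = mixture-zeros ys

  mixture-outside : ∀ {F} (ys : All (λ M → ∃ (R M)) F) j → All (λ M → lookup M j ≡ false) F →
    ∀ z → lookup (mixture x ys z) j ≡ lookup x j
  mixture-outside [] j [] [] = refl
  mixture-outside (_ ∷ ys) j (_ ∷ out) (false ∷ z) = mixture-outside ys j out z
  mixture-outside (_∷_ {x = M} (y , _) ys) j (outM ∷ out) (true ∷ z) =
    trans (lookup-overwrite M y (mixture x ys z) j)
      (trans (cong (λ b → if b then lookup y j else lookup (mixture x ys z) j) outM) (mixture-outside ys j out z))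

  -- By disjointness at most one block contains j, so bit j of the mixture is an affine function of
  -- at most one bit of z.
  mixture-multiplier : ∀ {F} (ys : All (λ M → ∃ (R M)) F) → AllPairs Disjoint F →
    ∀ j → Multiplier (length F) (λ z → bitℚ (lookup (mixture x ys z) j))
  mixture-multiplier [] _ j zero {g} p = tt
  mixture-multiplier [] _ j (suc d) p = tt
  mixture-multiplier {M ∷ F} (y ∷ ys) _ j zero {g} p =
    DegLt-ext (suc (length F)) 1 (λ z → trans (cong (bitℚ (lookup (mixture x (y ∷ ys) z) j) *_) (p z)) (*-zeroʳ (bitℚ (lookup (mixture x (y ∷ ys) z) j))))
      (DegLt-0 (suc (length F)) 1)
  mixture-multiplier {M ∷ F} ((y , _) ∷ ys) (disj ∷ disjs) j (suc d) {g} p with lookup M j in eq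
  ... | false =
    mixture-multiplier ys disjs j (suc d) (proj₁ p) ,
    DegLt-ext (length F) (suc d)
      (λ z → trans (cong (λ b → bitℚ b * g (true ∷ z) - bitℚ (lookup (mixture x ys z) j) * g (false ∷ z))
                     (trans (lookup-overwrite M y (mixture x ys z) j) (cong (λ b → if b then lookup y j else lookup (mixture x ys z) j) eq)))
                   (step (bitℚ (lookup (mixture x ys z) j)) (g (true ∷ z)) (g (false ∷ z))))
      (mixture-multiplier ys disjs j d (proj₂ p))
    where
    step : ∀ a u v → a * u - a * v ≡ a * (u - v)
    step = solve-∀ ringℚ
  -- Bit j is that of y or of x according to the first bit of z; it ignores the other bits, since no
  -- later block contains j.
  ... | true =
    DegLt-ext (length F) (suc (suc d)) (λ z → trans (cong (λ b → bitℚ b * g (false ∷ z)) (constant z)) (step₀ (bitℚ (lookup x j)) (g (false ∷ z))))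
      (DegLt-suc (length F) (suc d) (DegLt-linear (length F) (suc d) (bitℚ (lookup x j)) 0ℚ (proj₁ p) (proj₁ p))) ,
    DegLt-ext (length F) (suc d)
      (λ z → trans (cong₂ (λ b c → bitℚ b * g (true ∷ z) - bitℚ c * g (false ∷ z))
                     (trans (lookup-overwrite M y (mixture x ys z) j) (cong (λ b → if b then lookup y j else lookup (mixture x ys z) j) eq))
                     (constant z))
                   (step₁ (bitℚ (lookup y j)) (bitℚ (lookup x j)) (g (true ∷ z)) (g (false ∷ z))))
      (DegLt-linear (length F) (suc d) (bitℚ (lookup y j)) (- bitℚ (lookup x j)) (DegLt-at-true (length F) (suc d) {g} p) (proj₁ p))
    where
    constant : ∀ z → lookup (mixture x ys z) j ≡ lookup x j
    constant = mixture-outside ys j (All.map (λ {M′} apart → ¬-not (λ in′ → apart (j , eq , in′))) disj)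
    step₀ : ∀ a u → a * u ≡ a * u + 0ℚ * u
    step₀ = solve-∀ ringℚ
    step₁ : ∀ a b u v → a * u - b * v ≡ a * u + (- b) * v
    step₁ = solve-∀ ringℚ

mixture-flips : ∀ {n} (q : Input n → ℚ) x {F} (ys : All (λ M → ∃ λ y → q (overwrite M y x) < 0ℚ) F) →
  FlipsNegative (length F) (λ z → q (mixture x ys z))
mixture-flips q x [] = tt
mixture-flips q x {M ∷ F} ((y , neg) ∷ ys) =
  subst (λ v → q (overwrite M y v) < 0ℚ) (sym (mixture-zeros x ys)) neg , mixture-flips q x ys

-- The sign polynomial at a maximum of its absolute value.

sign : Bool → ℚ
sign false = 1ℚ
sign true = - 1ℚ

-- Hence `sign (f x) * eval p x` is the absolute value of p at x, and serves as such below.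
SignRep-positive : ∀ {n} {f : BoolFun n} {p} → SignRep f p → ∀ x → 0ℚ < sign (f x) * eval p x
SignRep-positive {f = f} {p} rep x with f x | rep x
... | true | _ , _ , negative = subst₂ _<_ refl (opposite (eval p x)) (neg-antimono-< (negative refl))
  where
  opposite : ∀ a → - a ≡ (- 1ℚ) * a
  opposite = solve-∀ ringℚ
... | false | ne , ¬negative , _ with <-cmp (eval p x) 0ℚ
...   | tri< neg _ _ with () ← ¬negative neg
...   | tri≈ _ eq _ = ⊥-elim (ne eq)
...   | tri> _ _ pos = subst (0ℚ <_) (sym (*-identityˡ (eval p x))) pos

sign-not : ∀ b a → sign b * a ≡ - (sign (not b) * a)
sign-not true a = step a
  where
  step : ∀ a → (- 1ℚ) * a ≡ - (1ℚ * a)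
  step = solve-∀ ringℚ
sign-not false a = step a
  where
  step : ∀ a → 1ℚ * a ≡ - ((- 1ℚ) * a)
  step = solve-∀ ringℚ

sign-≤ : ∀ b c {a} → 0ℚ < sign c * a → sign b * a ≤ sign c * a
sign-≤ true true pos = ≤-refl
sign-≤ false false pos = ≤-refl
sign-≤ true false {a} pos = ≤-trans (subst (_≤ 0ℚ) (sym (sign-not true a)) (neg-antimono-≤ (<⇒≤ pos))) (<⇒≤ pos)
sign-≤ false true {a} pos = ≤-trans (subst (_≤ 0ℚ) (sym (sign-not false a)) (neg-antimono-≤ (<⇒≤ pos))) (<⇒≤ pos)

argmax : ∀ {n} (g : Input n → ℚ) → ∃ λ x → ∀ y → g y ≤ g x
argmax {zero} g = [] , λ where [] → ≤-refl
argmax {suc n} g with argmax (g ∘ (false ∷_)) | argmax (g ∘ (true ∷_))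
... | x₀ , max₀ | x₁ , max₁ with ≤-total (g (false ∷ x₀)) (g (true ∷ x₁))
...   | inj₁ le = true ∷ x₁ , λ where
  (false ∷ y) → ≤-trans (max₀ y) le
  (true ∷ y) → max₁ y
...   | inj₂ ge = false ∷ x₀ , λ where
  (false ∷ y) → max₀ y
  (true ∷ y) → ≤-trans (max₁ y) ge

-- `flips-bound` is applied to q along the mixtures, q being p with its sign made positive at x. One
-- flip changes f, so q becomes negative; maximality at x supplies both the upper and the lower
-- bound.
disjoint-flips-bound : ∀ {n} {f : BoolFun n} {p} s → SignRep f p → DegLe p s →
  ∀ x → (∀ y → sign (f y) * eval p y ≤ sign (f x) * eval p x) →
  ∀ F → AllPairs Disjoint F → All (λ M → ∃ λ y → f (overwrite M y x) ≡ not (f x)) F →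
  length F ℕ.≤ 3 ℕ.* (s ℕ.* s)
disjoint-flips-bound {n} {f} {p} s rep deg x maximal F disjoint flips =
  flips-bound (length F) s
    (DegLt-ext (length F) (suc s) (λ z → step (sign (f x)) (eval p (mixture x ys z)))
      (DegLt-linear (length F) (suc s) (sign (f x)) 0ℚ degree degree))
    (mixture-flips q x ys)
    (subst (λ v → 0ℚ < q v) (sym start) (SignRep-positive {f = f} {p} rep x))
    (λ z → subst (λ v → q (mixture x ys z) ≤ q v) (sym start) (dominated (f x) (mixture x ys z)))
    (λ z → subst (λ v → - q (mixture x ys z) ≤ q v) (sym start)
      (subst (_≤ q x) (opposite (mixture x ys z)) (dominated (not (f x)) (mixture x ys z))))
  where
  q : Input n → ℚ
  q y = sign (f x) * eval p y
  positive-at = SignRep-positive {f = f} {p} rep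
  dominated : ∀ b y → sign b * eval p y ≤ q x
  dominated b y = ≤-trans (sign-≤ b (f y) (positive-at y)) (maximal y)
  double-negation : ∀ a → a ≡ - (- a)
  double-negation = solve-∀ ringℚ
  opposite : ∀ y → sign (not (f x)) * eval p y ≡ - q y
  opposite y = trans (double-negation _) (cong -_ (sym (sign-not (f x) (eval p y))))
  negative : ∀ y → f y ≡ not (f x) → q y < 0ℚ
  negative y eq = subst (_< 0ℚ) (sym (sign-not (f x) (eval p y)))
    (neg-antimono-< (subst (λ b → 0ℚ < sign b * eval p y) eq (positive-at y)))
  ys : All (λ M → ∃ λ y → q (overwrite M y x) < 0ℚ) F
  ys = All.map (λ {M} (y , eq) → y , negative (overwrite M y x) eq) flips
  start : mixture x ys (replicate (length F) false) ≡ x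
  start = mixture-zeros x ys
  degree : DegLt (length F) (suc s) (λ z → eval p (mixture x ys z))
  degree = eval-DegLt p (suc s) (λ S ne → ℕ.s≤s (deg S ne)) (mixture x ys) (mixture-multiplier x ys disjoint)
  step : ∀ a u → a * u ≡ a * u + 0ℚ * u
  step = solve-∀ ringℚ

-- Maximal disjoint families and their variables.

allSubsets-complete : ∀ {n} (S : Vec Bool n) → S ∈ allSubsets n
allSubsets-complete [] = here refl
allSubsets-complete {suc n} (false ∷ S) = ∈-++⁺ˡ (∈-map⁺ (false ∷_) (allSubsets-complete S))
allSubsets-complete {suc n} (true ∷ S) = ∈-++⁺ʳ (List.map (false ∷_) (allSubsets n)) (∈-map⁺ (true ∷_) (allSubsets-complete S))

meets-self : ∀ {n} (S : Vec Bool n) → 0 ℕ.< weight S → Meets S S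
meets-self (true ∷ S) _ = zero , refl , refl
meets-self (false ∷ S) pos with meets-self S pos
... | j , in₁ , in₂ = suc j , in₁ , in₂

-- Greedy choice along the list. The second hypothesis excludes the empty set, which does not even
-- meet itself.
maximal-disjoint : ∀ {n} {Q : Vec Bool n → Set} → Decidable Q → (∀ {S} → Q S → Meets S S) → ∀ L →
  ∃ λ F → All Q F × AllPairs Disjoint F × (∀ {S} → S ∈ L → Q S → Any (Meets S) F)
maximal-disjoint Q? self [] = [] , [] , [] , λ ()
maximal-disjoint Q? self (S ∷ L) with maximal-disjoint Q? self L
... | F , all , disjoint , hit with Q? S | Any.any? (meets? S) F
...   | no ¬QS | _ = F , all , disjoint , λ where
  (here refl) QS → contradiction QS ¬QS
  (there S∈L) → hit S∈L
...   | yes QS | yes met = F , all , disjoint , λ where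
  (here refl) _ → met
  (there S∈L) → hit S∈L
...   | yes QS | no ¬met = S ∷ F , QS ∷ all , ¬Any⇒All¬ F ¬met ∷ disjoint , λ where
  (here refl) _ → here (self QS)
  (there S∈L) QS′ → there (hit S∈L QS′)

elements : ∀ {n} → Vec Bool n → List (Fin n)
elements [] = []
elements (true ∷ M) = zero ∷ List.map suc (elements M)
elements (false ∷ M) = List.map suc (elements M)

length-elements : ∀ {n} (M : Vec Bool n) → length (elements M) ≡ weight M
length-elements [] = refl
length-elements (true ∷ M) = cong suc (trans (List.length-map suc (elements M)) (length-elements M))
length-elements (false ∷ M) = trans (List.length-map suc (elements M)) (length-elements M)

elements-complete : ∀ {n} (M : Vec Bool n) j → lookup M j ≡ true → j ∈ elements M
elements-complete (true ∷ M) zero eq = here refl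
elements-complete (true ∷ M) (suc j) eq = there (∈-map⁺ suc (elements-complete M j eq))
elements-complete (false ∷ M) (suc j) eq = ∈-map⁺ suc (elements-complete M j eq)

Hits : ∀ {n} → List (Fin n) → Vec Bool n → Set
Hits U S = Any (λ j → lookup S j ≡ true) U

meets⇒hits : ∀ {n} {S M : Vec Bool n} → Meets S M → Hits (elements M) S
meets⇒hits {S = S} {M} (j , inS , inM) = Any.map (λ eq → subst (λ i → lookup S i ≡ true) eq inS) (elements-complete M j inM)

any-meets⇒hits : ∀ {n} {S : Vec Bool n} {F} → Any (Meets S) F → Hits (concatMap elements F) S
any-meets⇒hits {S = S} {M ∷ F} (here met) = ++⁺ˡ (meets⇒hits {S = S} {M} met)
any-meets⇒hits {S = S} {M ∷ F} (there met) = ++⁺ʳ (elements M) (any-meets⇒hits {S = S} met)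

length-concatMap-elements : ∀ {n d} {F : List (Vec Bool n)} → All (λ M → weight M ≡ d) F →
  length (concatMap elements F) ≡ length F ℕ.* d
length-concatMap-elements [] = refl
length-concatMap-elements {F = M ∷ F} (wt ∷ wts) =
  trans (List.length-++ (elements M)) (cong₂ ℕ._+_ (trans (length-elements M) wt) (length-concatMap-elements wts))

-- Representations along a path of the decision tree.

-- The two detecting polynomials have separate degree bounds because a round of queries lowers only
-- one of them.
record Representation {n} (f : BoolFun n) (s : ℕ) (d : Bool → ℕ) : Set where
  field
    signPoly : MLPoly n
    signRep : SignRep f signPoly
    signDeg : DegLe signPoly s
    detect : Bool → MLPoly n
    detected : ∀ c x → eval (detect c) x ≢ 0ℚ → f x ≡ c
    detects : ∀ c x → f x ≡ c → eval (detect c) x ≢ 0ℚ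
    detectDeg : ∀ c → DegLe (detect c) (d c)

open Representation

fix : ∀ {n} → Fin n → Bool → BoolFun n → BoolFun n
fix i b f x = f (x [ i ]≔ b)

restrict-representation : ∀ {n} {f : BoolFun n} {s d} i b → Representation f s d → Representation (fix i b f) s d
restrict-representation i b R = record
  { signPoly = restrict i b (signPoly R)
  ; signRep = λ x → subst (λ v → (v ≢ 0ℚ) × ((v < 0ℚ → _) × (_ → v < 0ℚ))) (sym (eval-restrict i b (signPoly R) x)) (signRep R (x [ i ]≔ b))
  ; signDeg = restrict-DegLe i b (signDeg R)
  ; detect = λ c → restrict i b (detect R c)
  ; detected = λ c x ne → detected R c (x [ i ]≔ b) (λ eq → ne (trans (eval-restrict i b (detect R c) x) eq))
  ; detects = λ c x eq z → detects R c (x [ i ]≔ b) eq (trans (sym (eval-restrict i b (detect R c) x)) z)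
  ; detectDeg = λ c → restrict-DegLe i b (detectDeg R c)
  }

lower : Bool → (Bool → ℕ) → Bool → ℕ
lower true d true = ℕ.pred (d true)
lower true d false = d false
lower false d true = d true
lower false d false = ℕ.pred (d false)

lower-representation : ∀ {n} {f : BoolFun n} {s d} c (R : Representation f s d) →
  DegLe (detect R c) (ℕ.pred (d c)) → Representation f s (lower c d)
lower-representation {d = d} c R deg = record
  { signPoly = signPoly R
  ; signRep = signRep R
  ; signDeg = signDeg R
  ; detect = detect R
  ; detected = detected R
  ; detects = detects R
  ; detectDeg = lowered c deg
  }
  where
  lowered : ∀ c → DegLe (detect R c) (ℕ.pred (d c)) → ∀ b → DegLe (detect R b) (lower c d b)
  lowered true deg true = deg
  lowered true deg false = detectDeg R false
  lowered false deg true = detectDeg R true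
  lowered false deg false = deg

DLe-mono : ∀ {n} {f : BoolFun n} {k l} → k ℕ.≤ l → DLe f k → DLe f l
DLe-mono k≤l (t , correct , shallow) = t , correct , ℕ.≤-trans shallow k≤l

DLe-query : ∀ {n} {f : BoolFun n} {k} i → (∀ b → DLe (fix i b f) k) → DLe f (suc k)
DLe-query {f = f} i branch with branch false | branch true
... | t₀ , correct₀ , shallow₀ | t₁ , correct₁ , shallow₁ =
  query i t₀ t₁ , correct , ℕ.s≤s (ℕ.⊔-lub shallow₀ shallow₁)
  where
  correct : ∀ x → (if lookup x i then runTree t₁ x else runTree t₀ x) ≡ f x
  correct x with lookup x i in eq
  ... | true = trans (correct₁ x) (cong f (trans (cong (x [ i ]≔_) (sym eq)) ([]≔-lookup x i)))
  ... | false = trans (correct₀ x) (cong f (trans (cong (x [ i ]≔_) (sym eq)) ([]≔-lookup x i)))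

-- Fixing a variable creates no new top monomial: one could only come from itself or from a monomial
-- of degree d c + 1. So the top monomials that remain are hit by the variables still to be queried,
-- and once these run out none is left.
query-all : ∀ {n s d k} c U {f : BoolFun n} (R : Representation f s d) →
  (∀ S → detect R c S ≢ 0ℚ → weight S ≡ d c → Hits U S) →
  (∀ {g : BoolFun n} → Representation g s (lower c d) → DLe g k) → DLe f (length U ℕ.+ k)
query-all {d = d} c [] R cover continue = continue (lower-representation c R smaller)
  where
  smaller : DegLe (detect R c) (ℕ.pred (d c))
  smaller S ne = ℕ.<⇒≤pred (ℕ.≤∧≢⇒< (detectDeg R c S ne) λ eq → contradiction (cover S ne eq) λ ())
query-all {d = d} c (i ∷ U) R cover continue =
  DLe-query i λ b → query-all c U (restrict-representation i b R) (cover′ b) continue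
  where
  cover′ : ∀ b S → restrict i b (detect R c) S ≢ 0ℚ → weight S ≡ d c → Hits U S
  cover′ b S ne wt with restrict-nonzero i b (detect R c) S ne
  ... | out , inj₂ ne′ = contradiction (detectDeg R c _ ne′) (ℕ.<⇒≱ (subst (λ w → d c ℕ.< w) (sym (weight-insert S i out)) (ℕ.s≤s (ℕ.≤-reflexive (sym wt)))))
  ... | out , inj₁ ne′ with cover S ne′ wt
  ...   | here in′ with () ← trans (sym in′) out
  ...   | there hit = hit

eval-constant : ∀ {n} (p : MLPoly n) → DegLe p 0 → ∀ x → eval p x ≡ p (replicate n false)
eval-constant p deg [] = eval-[] p
eval-constant {suc n} p deg (b ∷ x) = begin
  eval p (b ∷ x)                                            ≡⟨ eval-∷ p b x ⟩
  eval (p ∘ (false ∷_)) x + bitℚ b * eval (p ∘ (true ∷_)) x ≡⟨ cong₂ (λ u v → u + bitℚ b * v) (eval-constant (p ∘ (false ∷_)) (λ S → deg (false ∷ S)) x) (eval-vanishes (p ∘ (true ∷_)) vanish x) ⟩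
  p₀ + bitℚ b * 0ℚ                                          ≡⟨ cong (p₀ +_) (*-zeroʳ (bitℚ b)) ⟩
  p₀ + 0ℚ                                                   ≡⟨ +-identityʳ p₀ ⟩
  p₀                                                        ∎
  where
  open ≡-Reasoning
  p₀ = p (replicate (suc n) false)
  vanish : ∀ S → p (true ∷ S) ≡ 0ℚ
  vanish S = decidable-stable (p (true ∷ S) ≟ 0ℚ) (λ ne → ℕ.n≮0 (deg (true ∷ S) ne))

-- A detecting polynomial of degree 0 is nonzero everywhere or nowhere.
DLe-constant : ∀ {n} {f : BoolFun n} {s d k} c → Representation f s d → d c ≡ 0 → DLe f k
DLe-constant {n} {f} {k = k} c R eq = leaf (f x₀) , (λ x → constant x₀ x) , ℕ.z≤n
  where
  x₀ : Input n
  x₀ = replicate n false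
  same : ∀ x y → eval (detect R c) x ≡ eval (detect R c) y
  same x y = trans (value x) (sym (value y))
    where value = eval-constant (detect R c) (subst (DegLe (detect R c)) eq (detectDeg R c))
  transfer : ∀ x y → f x ≡ c → f y ≡ c
  transfer x y fx = detected R c y (subst (_≢ 0ℚ) (same x y) (detects R c x fx))
  constant : ∀ x y → f x ≡ f y
  constant x y with f x ≟ᵇ c
  ... | yes fx = trans fx (sym (transfer x y fx))
  ... | no fx≢c = trans (¬-not fx≢c) (sym (¬-not (λ fy → fx≢c (transfer y x fy))))

-- The query strategy and its cost.

triangular : ℕ → ℕ
triangular zero = 0
triangular (suc a) = suc a ℕ.+ triangular a

-- The − 1 is the saved last step: at degree 0 the function is already constant.
cost : ℕ → ℕ → ℕ
cost a b = triangular a ℕ.+ triangular b ℕ.∸ 1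

cost-true : ∀ a b → suc a ℕ.+ cost a (suc b) ≡ cost (suc a) (suc b)
cost-true a b = trans (cong (λ w → suc a ℕ.+ (w ℕ.∸ 1)) (ℕ.+-suc (triangular a) (b ℕ.+ triangular b)))
  (cong (ℕ._∸ 1) (step a (triangular a) (b ℕ.+ triangular b)))
  where
  step : ∀ a t u → suc (suc a ℕ.+ (t ℕ.+ u)) ≡ suc a ℕ.+ t ℕ.+ suc u
  step = solve-∀ℕ

cost-false : ∀ a b → suc b ℕ.+ cost (suc a) b ≡ cost (suc a) (suc b)
cost-false a b = step a b (triangular a) (triangular b)
  where
  step : ∀ a b t u → suc b ℕ.+ (a ℕ.+ t ℕ.+ u) ≡ a ℕ.+ t ℕ.+ (suc b ℕ.+ u)
  step = solve-∀ℕ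

-- The value of f at the maximiser x dictates which detecting polynomial is attacked, so either
-- degree may fall in a round and the cost counts both. The equations for d let the recursion
-- descend on a and b.
decide : ∀ {n s} a b d {f : BoolFun n} → d true ≡ a → d false ≡ b → Representation f s d →
  DLe f (3 ℕ.* (s ℕ.* s) ℕ.* cost a b)
decide zero b d eq₁ eq₀ R = DLe-constant true R eq₁
decide (suc a) zero d eq₁ eq₀ R = DLe-constant false R eq₀
decide {n} {s} (suc a) (suc b) d {f} eq₁ eq₀ R = proceed (not (f x)) refl
  where
  κ = 3 ℕ.* (s ℕ.* s)
  maximum = argmax (λ y → sign (f y) * eval (signPoly R) y)
  x = proj₁ maximum
  descend : ∀ c k → not (f x) ≡ c → 0 ℕ.< d c → (∀ {g : BoolFun n} → Representation g s (lower c d) → DLe g k) →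
    DLe f (κ ℕ.* d c ℕ.+ k)
  descend c k target pos continue = DLe-mono (ℕ.+-monoˡ-≤ k short)
    (query-all c U R (λ S ne wt → any-meets⇒hits {S = S} (hit (allSubsets-complete S) (ne , wt))) continue)
    where
    Top : Vec Bool n → Set
    Top S = detect R c S ≢ 0ℚ × weight S ≡ d c
    top? : Decidable Top
    top? S = ¬? (detect R c S ≟ 0ℚ) ×-dec (weight S ℕ.≟ d c)
    family = maximal-disjoint top? (λ {S} (_ , wt) → meets-self S (subst (0 ℕ.<_) (sym wt) pos)) (allSubsets n)
    F = proj₁ family
    tops = proj₁ (proj₂ family)
    hit = proj₂ (proj₂ (proj₂ family))
    U = concatMap elements F
    flip : ∀ {M} → Top M → ∃ λ y → f (overwrite M y x) ≡ not (f x)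
    flip {M} (ne , wt) with nonzero-inside-maxonomial (detect R c) (d c) (detectDeg R c) M wt ne x
    ... | y , ne′ = y , trans (detected R c (overwrite M y x) ne′) (sym target)
    few : length F ℕ.≤ κ
    few = disjoint-flips-bound {p = signPoly R} s (signRep R) (signDeg R) x (proj₂ maximum) F (proj₁ (proj₂ (proj₂ family))) (All.map flip tops)
    short : length U ℕ.≤ κ ℕ.* d c
    short = ℕ.≤-trans (ℕ.≤-reflexive (length-concatMap-elements (All.map proj₂ tops))) (ℕ.*-monoˡ-≤ (d c) few)
  proceed : ∀ c → not (f x) ≡ c → DLe f (κ ℕ.* cost (suc a) (suc b))
  proceed true target = subst (DLe f)
    (trans (cong (λ w → κ ℕ.* w ℕ.+ κ ℕ.* cost a (suc b)) eq₁) (trans (sym (ℕ.*-distribˡ-+ κ (suc a) (cost a (suc b)))) (cong (κ ℕ.*_) (cost-true a b))))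
    (descend true _ target (subst (0 ℕ.<_) (sym eq₁) (ℕ.s≤s ℕ.z≤n)) (decide a (suc b) (lower true d) (cong ℕ.pred eq₁) eq₀))
  proceed false target = subst (DLe f)
    (trans (cong (λ w → κ ℕ.* w ℕ.+ κ ℕ.* cost (suc a) b) eq₀) (trans (sym (ℕ.*-distribˡ-+ κ (suc b) (cost (suc a) b))) (cong (κ ℕ.*_) (cost-false a b))))
    (descend false _ target (subst (0 ℕ.<_) (sym eq₀) (ℕ.s≤s ℕ.z≤n)) (decide (suc a) b (lower false d) eq₁ (cong ℕ.pred eq₀)))

-- Assembling the bound.

representation : ∀ {n} {f : BoolFun n} {s r} → SdegLe f s → RdegLe f r → Representation f s (λ _ → r)
representation {n} {f} {s} {r} (g , signRep , signDeg) (p , q , rat , degP , degQ) = record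
  { signPoly = g
  ; signRep = signRep
  ; signDeg = signDeg
  ; detect = det
  ; detected = found
  ; detects = finds
  ; detectDeg = deg
  }
  where
  det : Bool → MLPoly n
  det true = p
  det false S = q S + (- 1ℚ) * p S
  difference : ∀ x → eval (det false) x ≡ eval q x - bitℚ (f x) * eval q x
  difference x = trans (eval-linear 1ℚ (- 1ℚ) q p (λ S → cong (_+ (- 1ℚ) * p S) (sym (*-identityˡ (q S)))) x)
    (trans (step (eval q x) (eval p x)) (cong (λ w → eval q x - w) (proj₂ (rat x))))
    where
    step : ∀ u v → 1ℚ * u + (- 1ℚ) * v ≡ u - v
    step = solve-∀ ringℚ
  -×0 : ∀ u → u - 0ℚ * u ≡ u
  -×0 = solve-∀ ringℚ
  -×1 : ∀ u → u - 1ℚ * u ≡ 0ℚ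
  -×1 = solve-∀ ringℚ
  found : ∀ c x → eval (det c) x ≢ 0ℚ → f x ≡ c
  found true x ne = ¬-not λ eq → ne (trans (proj₂ (rat x)) (trans (cong (λ b → bitℚ b * eval q x) eq) (*-zeroˡ (eval q x))))
  found false x ne = ¬-not λ eq → ne (trans (difference x) (trans (cong (λ b → eval q x - bitℚ b * eval q x) eq) (-×1 (eval q x))))
  finds : ∀ c x → f x ≡ c → eval (det c) x ≢ 0ℚ
  finds true x eq z = proj₁ (rat x) (trans (sym (*-identityˡ (eval q x))) (trans (cong (λ b → bitℚ b * eval q x) (sym eq)) (trans (sym (proj₂ (rat x))) z)))
  finds false x eq z = proj₁ (rat x) (trans (sym (-×0 (eval q x))) (trans (cong (λ b → eval q x - bitℚ b * eval q x) (sym eq)) (trans (sym (difference x)) z)))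
  deg : ∀ c → DegLe (det c) r
  deg true = degP
  deg false S ne with nonzero-summand (- 1ℚ) ne
  ... | inj₁ ne′ = degQ S ne′
  ... | inj₂ ne′ = degP S ne′

double-triangular : ∀ r → triangular r ℕ.+ triangular r ≡ r ℕ.* r ℕ.+ r
double-triangular zero = refl
double-triangular (suc r) = trans (step r (triangular r)) (trans (cong (λ w → r ℕ.+ r ℕ.+ 2 ℕ.+ w) (double-triangular r)) (step′ r))
  where
  step : ∀ r t → suc r ℕ.+ t ℕ.+ (suc r ℕ.+ t) ≡ r ℕ.+ r ℕ.+ 2 ℕ.+ (t ℕ.+ t)
  step = solve-∀ℕ
  step′ : ∀ r → r ℕ.+ r ℕ.+ 2 ℕ.+ (r ℕ.* r ℕ.+ r) ≡ suc r ℕ.* suc r ℕ.+ suc r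
  step′ = solve-∀ℕ

-- For positive r the cost is r² + r - 1, and 4r² - 3(r² + r - 1) is m² - m + 1 with r = m + 1.
-- Without the saved step the bound would fail at r = 1 and r = 2.
cost-bound : ∀ r → 3 ℕ.* cost r r ℕ.≤ 4 ℕ.* r ℕ.^ 2
cost-bound zero = ℕ.z≤n
cost-bound (suc m) = begin
  3 ℕ.* cost (suc m) (suc m)                             ≡⟨ cong (λ w → 3 ℕ.* (w ℕ.∸ 1)) (double-triangular (suc m)) ⟩
  3 ℕ.* (suc m ℕ.* suc m ℕ.+ suc m ℕ.∸ 1)                ≡⟨ cong (λ w → 3 ℕ.* (w ℕ.∸ 1)) (step m) ⟩
  3 ℕ.* (m ℕ.* m ℕ.+ 3 ℕ.* m ℕ.+ 1)                      ≡⟨ step₁ m ⟩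
  m ℕ.+ (3 ℕ.* (m ℕ.* m) ℕ.+ 8 ℕ.* m ℕ.+ 3)              ≤⟨ ℕ.+-monoˡ-≤ _ (m≤m*m m) ⟩
  m ℕ.* m ℕ.+ (3 ℕ.* (m ℕ.* m) ℕ.+ 8 ℕ.* m ℕ.+ 3)        ≤⟨ ℕ.n≤1+n _ ⟩
  suc (m ℕ.* m ℕ.+ (3 ℕ.* (m ℕ.* m) ℕ.+ 8 ℕ.* m ℕ.+ 3))  ≡⟨ step₂ m ⟩
  4 ℕ.* suc m ℕ.^ 2                                      ∎
  where
  open ℕ.≤-Reasoning
  m≤m*m : ∀ m → m ℕ.≤ m ℕ.* m
  m≤m*m zero = ℕ.z≤n
  m≤m*m (suc m) = ℕ.m≤m*n (suc m) (suc m)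
  step : ∀ m → suc m ℕ.* suc m ℕ.+ suc m ≡ suc (m ℕ.* m ℕ.+ 3 ℕ.* m ℕ.+ 1)
  step = solve-∀ℕ
  step₁ : ∀ m → 3 ℕ.* (m ℕ.* m ℕ.+ 3 ℕ.* m ℕ.+ 1) ≡ m ℕ.+ (3 ℕ.* (m ℕ.* m) ℕ.+ 8 ℕ.* m ℕ.+ 3)
  step₁ = solve-∀ℕ
  step₂ : ∀ m → suc (m ℕ.* m ℕ.+ (3 ℕ.* (m ℕ.* m) ℕ.+ 8 ℕ.* m ℕ.+ 3)) ≡ 4 ℕ.* (suc m ℕ.* (suc m ℕ.* 1))
  step₂ = solve-∀ℕ

theorem3p5 : (n : ℕ) (f : BoolFun n) (s r : ℕ) →
    SdegLe f s → RdegLe f r → DLe f (4 ℕ.* (s ℕ.^ 2) ℕ.* (r ℕ.^ 2))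
theorem3p5 n f s r sdeg rdeg = DLe-mono bound (decide r r (λ _ → r) refl refl (representation sdeg rdeg))
  where
  open ℕ.≤-Reasoning
  regroup₁ : ∀ s c → 3 ℕ.* (s ℕ.* s) ℕ.* c ≡ s ℕ.* s ℕ.* (3 ℕ.* c)
  regroup₁ = solve-∀ℕ
  regroup₂ : ∀ s t → s ℕ.* s ℕ.* (4 ℕ.* t) ≡ 4 ℕ.* (s ℕ.* (s ℕ.* 1)) ℕ.* t
  regroup₂ = solve-∀ℕ
  bound : 3 ℕ.* (s ℕ.* s) ℕ.* cost r r ℕ.≤ 4 ℕ.* (s ℕ.^ 2) ℕ.* (r ℕ.^ 2)
  bound = begin
    3 ℕ.* (s ℕ.* s) ℕ.* cost r r    ≡⟨ regroup₁ s (cost r r) ⟩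
    s ℕ.* s ℕ.* (3 ℕ.* cost r r)    ≤⟨ ℕ.*-monoʳ-≤ (s ℕ.* s) (cost-bound r) ⟩
    s ℕ.* s ℕ.* (4 ℕ.* r ℕ.^ 2)     ≡⟨ regroup₂ s (r ℕ.^ 2) ⟩
    4 ℕ.* (s ℕ.^ 2) ℕ.* (r ℕ.^ 2)   ∎
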